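{- Let $G$ be a critical graph with $m$ edges. Then for all integers $t \geq 100\,m^3$, the graph $G \vee K_t$ is robustly critical.
   Context: All graphs are finite and simple. For an integer $k \geq 1$, a graph $G$ is $k$-critical if $\chi(G) = k$ and $\chi(G') < k$ for every proper subgraph $G'$ of $G$; $G$ is critical if it is $k$-critical for some $k \geq 1$. The join $G \vee H$ of graphs $G$ and $H$ is obtained from vertex-disjoint copies of $G$ and $H$ by making every vertex of $G$ adjacent to every vertex of $H$. $K_t$ is the complete graph on $t$ vertices. A cover of a graph $G$ is a pair $\mathcal{H} = (L,H)$, where $H$ is a graph and $L$ is a function assigning to each $v \in V(G)$ a subset $L(v) \subseteq V(H)$ such that: the sets $L(v)$, $v \in V(G)$, are pairwise disjoint, independent in $H$, and have union $V(H)$; and whenever (for distinct $u,v\in V(G)$) the set $E_H(L(u),L(v))$ of edges of $H$ between $L(u)$ and $L(v)$ is nonempty, then $uv \in E(G)$ and $E_H(L(u),L(v))$ is a matching (not necessarily perfect). A proper $\mathcal{H}$-coloring of $G$ is an independent set $T$ of $H$ containing exactly one vertex from each $L(v)$; $G$ is $\mathcal{H}$-colorable if one exists, and otherwise $\mathcal{H}$ is a bad cover of $G$. A cover is $q$-fold if $|L(v)| = q$ for all $v \in V(G)$ (with $q = 0$ allowed). A $q$-fold cover $\mathcal{H} = (L,H)$ of $G$ is canonical if there is a mapping $\lambda \colon V(H) \to [q]$, where $[q]=\{1,\ldots,q\}$, such that for each $v \in V(G)$ the restriction $\lambda|_{L(v)}$ is a bijection from $L(v)$ to $[q]$, and for all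 $uv \in E(G)$, $c \in L(u)$, $c' \in L(v)$, we have $cc' \in E(H)$ if and only if $\lambda(c) = \lambda(c')$. (In particular the $0$-fold cover is canonical.) For $k \geq 1$, a graph $G$ is robustly $k$-critical if it is $k$-critical and every bad $(k-1)$-fold cover of $G$ is canonical. $G$ is robustly critical if it is robustly $k$-critical for some $k \geq 1$. -}

module Defs where

open import Level using (0ℓ)
open import Data.Nat using (ℕ; _+_; _∸_; _≤_; _<_)
open import Data.Fin as Fin using (Fin; splitAt)
import Data.Fin.Properties as Fin
open import Data.Fin.Subset using (Subset; _∈_; _∉_; ∣_∣)
open import Data.List using (length; filter; allFin; cartesianProduct)
open import Data.Product using (∃; ∃!; _×_; _,_; proj₁; proj₂)
open import Data.Sum using (_⊎_; inj₁; inj₂)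
open import Data.Unit using (⊤; tt)
open import Function.Bundles using (_⇔_)
open import Function.Definitions using (Bijective)
open import Relation.Binary using (Rel; Decidable; Symmetric; Irreflexive)
open import Relation.Binary.PropositionalEquality using (_≡_; _≢_; sym)
open import Relation.Nullary using (¬_; yes; no)
open import Relation.Nullary.Decidable using (_×-dec_; ¬?)

record Graph (n : ℕ) : Set₁ where
  field
    Adj       : Rel (Fin n) 0ℓ
    adj?      : Decidable Adj
    symmetric : Symmetric Adj
    loopless  : Irreflexive _≡_ Adj

open Graph public

-- Each edge is counted once, as the pair of its endpoints in increasing order.
edgeCount : ∀ {n} → Graph n → ℕ
edgeCount {n} G =
  length (filter (λ e → (proj₁ e Fin.<? proj₂ e) ×-dec adj? G (proj₁ e) (proj₂ e))
                 (cartesianProduct (allFin n) (allFin n)))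

K : ∀ t → Graph t
K t = record
  { Adj       = _≢_
  ; adj?      = λ u v → ¬? (u Fin.≟ v)
  ; symmetric = λ u≢v v≡u → u≢v (sym v≡u)
  ; loopless  = λ u≡v u≢v → u≢v u≡v
  }

module _ {m n} (G : Graph m) (H : Graph n) where

  JoinAdj : Rel (Fin m ⊎ Fin n) 0ℓ
  JoinAdj (inj₁ u) (inj₁ v) = Adj G u v
  JoinAdj (inj₁ u) (inj₂ v) = ⊤
  JoinAdj (inj₂ u) (inj₁ v) = ⊤
  JoinAdj (inj₂ u) (inj₂ v) = Adj H u v

  joinAdj? : Decidable JoinAdj
  joinAdj? (inj₁ u) (inj₁ v) = adj? G u v
  joinAdj? (inj₁ u) (inj₂ v) = yes tt
  joinAdj? (inj₂ u) (inj₁ v) = yes tt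
  joinAdj? (inj₂ u) (inj₂ v) = adj? H u v

  joinAdj-sym : Symmetric JoinAdj
  joinAdj-sym {inj₁ u} {inj₁ v} e = symmetric G e
  joinAdj-sym {inj₁ u} {inj₂ v} e = tt
  joinAdj-sym {inj₂ u} {inj₁ v} e = tt
  joinAdj-sym {inj₂ u} {inj₂ v} e = symmetric H e

  joinAdj-irrefl : ∀ x → ¬ JoinAdj x x
  joinAdj-irrefl (inj₁ u) e = loopless G _≡_.refl e
  joinAdj-irrefl (inj₂ u) e = loopless H _≡_.refl e

infixr 6 _∨ᴳ_

-- The first m of the m + n vertices are those of G, the last n those of H.
_∨ᴳ_ : ∀ {m n} → Graph m → Graph n → Graph (m + n)
_∨ᴳ_ {m} {n} G H = record
  { Adj       = λ u v → JoinAdj G H (splitAt m u) (splitAt m v)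
  ; adj?      = λ u v → joinAdj? G H (splitAt m u) (splitAt m v)
  ; symmetric = λ {u} {v} → joinAdj-sym G H {splitAt m u} {splitAt m v}
  ; loopless  = λ { {u} _≡_.refl → joinAdj-irrefl G H (splitAt m u) }
  }

-- Colorings are defined for an arbitrary vertex type with an adjacency
-- relation, so that they apply both to graphs and to their subgraphs.

Colorable : {V : Set} → Rel V 0ℓ → ℕ → Set
Colorable {V} E k = ∃ λ (c : V → Fin k) → ∀ {u v} → E u v → c u ≢ c v

-- χ E ≐ k states that the chromatic number is k.
infix 4 χ_≐_

χ_≐_ : {V : Set} → Rel V 0ℓ → ℕ → Set
χ E ≐ k = Colorable E k × (∀ j → Colorable E j → k ≤ j)

record Subgraph {n} (G : Graph n) : Set₁ where
  field
    verts : Subset n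
    SAdj  : Rel (Fin n) 0ℓ
    sadj? : Decidable SAdj
    ssym  : Symmetric SAdj
    ends  : ∀ {u v} → SAdj u v → u ∈ verts × v ∈ verts
    sadj⊆ : ∀ {u v} → SAdj u v → Adj G u v

  Vertex : Set
  Vertex = ∃ (_∈ verts)

  VAdj : Rel Vertex 0ℓ
  VAdj x y = SAdj (proj₁ x) (proj₁ y)

  Proper : Set
  Proper = ¬ ((∀ v → v ∈ verts) × (∀ u v → Adj G u v → SAdj u v))

open Subgraph public

IsCritical : ∀ {n} → ℕ → Graph n → Set₁
IsCritical k G =
  (χ Adj G ≐ k) ×
  (∀ (G′ : Subgraph G) → Proper G′ → ∃ λ j → (χ VAdj G′ ≐ j) × j < k)

Critical : ∀ {n} → Graph n → Set₁
Critical G = ∃ λ k → 1 ≤ k × IsCritical k G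

-- E[ H ] A B relates a to b when ab is an edge of H with a ∈ A and b ∈ B.
E[_] : ∀ {N} → Graph N → Subset N → Subset N → Rel (Fin N) 0ℓ
E[ H ] A B a b = a ∈ A × b ∈ B × Adj H a b

-- For a relation between two disjoint sides: no two distinct edges share
-- an endpoint, on either side.
IsMatching : ∀ {N} → Rel (Fin N) 0ℓ → Set
IsMatching R = (∀ {a b b′} → R a b → R a b′ → b ≡ b′)
             × (∀ {a a′ b} → R a b → R a′ b → a ≡ a′)

record Cover {n} (G : Graph n) : Set₁ where
  field
    size        : ℕ
    H           : Graph size
    L           : Fin n → Subset size
    disjoint    : ∀ {u v c} → u ≢ v → c ∈ L u → c ∉ L v
    independent : ∀ {v c c′} → c ∈ L v → c′ ∈ L v → ¬ Adj H c c′
    union       : ∀ c → ∃ λ v → c ∈ L v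
    cross       : ∀ {u v} → u ≢ v →
                  (∃ λ c → ∃ λ c′ → E[ H ] (L u) (L v) c c′) →
                  Adj G u v × IsMatching (E[ H ] (L u) (L v))

module _ {n} {G : Graph n} (𝓗 : Cover G) where
  open Cover 𝓗

  IsProperColoring : Subset size → Set
  IsProperColoring T =
    (∀ {c c′} → c ∈ T → c′ ∈ T → ¬ Adj H c c′) ×
    (∀ v → ∃! _≡_ (λ c → c ∈ T × c ∈ L v))

  Bad : Set
  Bad = ¬ ∃ IsProperColoring

  IsFold : ℕ → Set
  IsFold q = ∀ v → ∣ L v ∣ ≡ q

  Canonical : ℕ → Set
  Canonical q = IsFold q × ∃ λ (lab : Fin size → Fin q) →
    (∀ v → Bijective _≡_ _≡_ (λ (x : ∃ (_∈ L v)) → lab (proj₁ x))) ×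
    (∀ u v → Adj G u v → ∀ c c′ → c ∈ L u → c′ ∈ L v →
       Adj H c c′ ⇔ lab c ≡ lab c′)

IsRobustlyCritical : ∀ {n} → ℕ → Graph n → Set₁
IsRobustlyCritical k G =
  IsCritical k G ×
  (∀ (𝓗 : Cover G) → IsFold 𝓗 (k ∸ 1) → Bad 𝓗 → Canonical 𝓗 (k ∸ 1))

RobustlyCritical : ∀ {n} → Graph n → Set₁
RobustlyCritical G = ∃ λ k → 1 ≤ k × IsRobustlyCritical k G

{-# OPTIONS --safe #-}

-- Let κ = k − 1, and color the vertices of K t one after the other, deleting the neighbors of each
-- color used from the lists that remain. A step costs every vertex v of G at most one color, and v is
-- saved a color when the color used has no neighbor left in the list of v, or when two of the colors
-- used have a common neighbor there. If nothing can be saved at v, then v is stuck: the remaining colors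
-- of K t are labelled consistently by the color of a fixed vertex a₀ of K t adjacent to them, and so are
-- their neighbors in the list of v.
--
-- If every vertex is stuck at the start, then the labels show that the cover is canonical, except that a
-- matching on an edge uv of G could miss a label i; then a κ-coloring of G − uv, in which u and v
-- have the same color i, gives a coloring of the cover. Otherwise let v₀ be the first vertex that is saved
-- a color, and go on saving until every other vertex is stuck or has so many colors that it may wait until
-- the end. Then color G − v₀ with κ labels that are kept free in K t and do not conflict across
-- the edges of G, and give v₀ one of its surplus colors.

module Submission where

open import Defs
open import Data.Empty using (⊥-elim)
open import Data.Fin as Fin using (Fin; zero; suc; splitAt; join; _↑ˡ_; _↑ʳ_; inject≤; punchOut)
import Data.Fin.Permutation.Components as Components
import Data.Fin.Properties as FinP
open import Data.Fin.Subset using (Subset; ⊤; ⁅_⁆; ∁; inside; outside; ∣_∣) renaming (_∈_ to _∈ˢ_; _∉_ to _∉ˢ_)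
open import Data.Fin.Subset.Properties using (_∈?_; drop-there; ∈⊤; x∈⁅x⁆; x∈∁p⇒x∉p; x∉p⇒x∈∁p; x≢y⇒x∉⁅y⁆)
open import Data.List using (List; []; _∷_; _++_; length; filter; map; concatMap; allFin; tabulate; lookup; cartesianProduct)
open import Data.List.Membership.Propositional using (_∈_; find; lose)
open import Data.List.Membership.Propositional.Properties
  using (∈-filter⁺; ∈-filter⁻; ∈-allFin; ∈-map⁺; ∈-map⁻; ∈-++⁺ˡ; ∈-++⁺ʳ; ∈-++⁻; ∈-cartesianProduct⁺; ∈-concatMap⁺; ∈-lookup)
open import Data.List.Properties using (filter-all; filter-notAll; length-map; length-++; length-tabulate)
open import Data.List.Relation.Unary.All as All using (All; []; _∷_)
open import Data.List.Relation.Unary.AllPairs using ([]; _∷_)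
open import Data.List.Relation.Unary.Any as Any using (Any; here; there)
open import Data.List.Relation.Unary.Any.Properties using (lookup-index)
open import Data.List.Relation.Unary.Unique.Propositional using (Unique)
open import Data.List.Relation.Unary.Unique.Propositional.Properties using (filter⁺; allFin⁺)
open import Data.Nat using (ℕ; zero; suc; _+_; _*_; _∸_; _^_; _≤_; _<_; z≤n; s≤s; s≤s⁻¹; _≤?_; _<?_)
open import Data.Nat.ListAction using (sum)
open import Data.Nat.Properties
open import Data.Nat.Solver using (module +-*-Solver)
open import Data.Product using (∃; ∃!; _×_; _,_; proj₁; proj₂)
open import Data.Sum as Sum using (_⊎_; inj₁; inj₂)
open import Data.Sum.Properties using (inj₂-injective) renaming (≡-dec to ⊎-≡-dec)
open import Data.Unit using (tt)
open import Data.Vec as Vec using (Vec; []; _∷_)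
import Data.Vec.Properties as Vec
open import Data.Vec.Properties.WithK using ([]=-irrelevant)
open import Function using (_∘_; id; mk⇔; _⇔_; Bijective)
open import Level using (0ℓ)
open import Relation.Binary using (Rel; tri<; tri≈; tri>)
open import Relation.Binary.PropositionalEquality hiding (J)
open import Relation.Nullary using (¬_; Dec; yes; no; does)
open import Relation.Nullary.Decidable using (¬?; _×-dec_; _⊎-dec_; _→-dec_; map′; dec-true)

-- Lists and sums

module _ {A : Set} where

  AtMostOne : (A → Set) → List A → Set
  AtMostOne Q xs = ∀ {x y} → x ∈ xs → y ∈ xs → Q x → Q y → x ≡ y

  -- Once an entry with `Q` is met, all later entries fail `Q` and survive the filter.
  length-filter-atMostOne : ∀ {Q : A → Set} (Q? : ∀ x → Dec (Q x)) {xs} → Unique xs → AtMostOne Q xs →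
    length xs ≤ suc (length (filter (λ x → ¬? (Q? x)) xs))
  length-filter-atMostOne Q? [] amo = z≤n
  length-filter-atMostOne Q? {x ∷ xs} (x∉ ∷ u) amo with Q? x
  ... | no _ = s≤s (length-filter-atMostOne Q? u λ p q → amo (there p) (there q))
  ... | yes qx = s≤s (≤-reflexive (sym (cong length (filter-all (λ y → ¬? (Q? y)) others))))
    where
    others = All.tabulate λ y∈ qy → All.lookup x∉ y∈ (amo (here refl) (there y∈) qx qy)

  -- Each index spoils at most one entry, so filtering index by index costs at most one entry each
  -- time. Most later choices of a color under finitely many constraints are made this way.
  thin : ∀ {I : Set} {Q : I → A → Set} (Q? : ∀ i x → Dec (Q i x)) (is : List I) {xs} → Unique xs →
    (∀ i → AtMostOne (Q i) xs) →
    ∃ λ ys → Unique ys × (∀ {y} → y ∈ ys → y ∈ xs × (∀ {i} → i ∈ is → ¬ Q i y)) ×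
             length xs ≤ length is + length ys
  thin Q? [] {xs} u amo = xs , u , (λ y∈ → y∈ , λ ()) , ≤-refl
  thin {Q = Q} Q? (i ∷ is) {xs} u amo
    with ys , uys , sub , len ← thin Q? is (filter⁺ (λ x → ¬? (Q? i x)) u)
           (λ j p q → amo j (proj₁ (∈-filter⁻ (λ x → ¬? (Q? i x)) p)) (proj₁ (∈-filter⁻ (λ x → ¬? (Q? i x)) q)))
    = ys , uys , sub′ , ≤-trans (length-filter-atMostOne (Q? i) u (amo i)) (s≤s len)
    where
    sub′ : ∀ {y} → y ∈ ys → y ∈ xs × (∀ {j} → j ∈ i ∷ is → ¬ Q j y)
    sub′ y∈ with y∈f , none ← sub y∈ with y∈xs , ¬q ← ∈-filter⁻ (λ x → ¬? (Q? i x)) y∈f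
      = y∈xs , λ { (here refl) → ¬q ; (there j∈) → none j∈ }

  -- A constructive search: in the main uses `P` is the existence of a saving, and `Q` what is known
  -- of an entry that yields none.
  either-all : ∀ {P : Set} {Q : A → Set} xs → (∀ {x} → x ∈ xs → P ⊎ Q x) → P ⊎ (∀ {x} → x ∈ xs → Q x)
  either-all [] h = inj₂ λ ()
  either-all (x ∷ xs) h with h (here refl) | either-all xs (h ∘ there)
  ... | inj₁ p | _ = inj₁ p
  ... | inj₂ _ | inj₁ p = inj₁ p
  ... | inj₂ q | inj₂ qs = inj₂ λ { (here refl) → q ; (there x∈) → qs x∈ }

  inhabited : ∀ {xs : List A} → 0 < length xs → ∃ (_∈ xs)
  inhabited {x ∷ xs} _ = x , here refl

  module _ {f g : A → ℕ} where

    sum-map-mono : ∀ xs → (∀ x → f x ≤ g x) → sum (map f xs) ≤ sum (map g xs)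
    sum-map-mono [] f≤g = z≤n
    sum-map-mono (x ∷ xs) f≤g = +-mono-≤ (f≤g x) (sum-map-mono xs f≤g)

    sum-map-strict : ∀ {x xs} → x ∈ xs → (∀ x → f x ≤ g x) → f x < g x → sum (map f xs) < sum (map g xs)
    sum-map-strict {xs = _ ∷ xs} (here refl) f≤g f<g = +-mono-<-≤ f<g (sum-map-mono xs f≤g)
    sum-map-strict (there x∈) f≤g f<g = +-mono-≤-< (f≤g _) (sum-map-strict x∈ f≤g f<g)

sum-map-≤ : ∀ {A : Set} {f : A → ℕ} {b} xs → (∀ x → f x ≤ b) → sum (map f xs) ≤ length xs * b
sum-map-≤ [] f≤b = z≤n
sum-map-≤ (x ∷ xs) f≤b = +-mono-≤ (f≤b x) (sum-map-≤ xs f≤b)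

-- Transitivity for the differences `r − b`, written without truncated subtraction: add the two
-- inequalities and cancel.
exchange : ∀ {r r₁ r₂ b b₁ b₂} → r + b₁ ≤ r₁ + b → r₁ + b₂ ≤ r₂ + b₁ → r + b₂ ≤ r₂ + b
exchange {r} {r₁} {r₂} {b} {b₁} {b₂} p q = +-cancelˡ-≤ (r₁ + b₁) _ _ (begin
  (r₁ + b₁) + (r + b₂)   ≡⟨ solve 4 (λ r r₁ b₁ b₂ → (r₁ :+ b₁) :+ (r :+ b₂) := (r :+ b₁) :+ (r₁ :+ b₂)) refl r r₁ b₁ b₂ ⟩
  (r + b₁) + (r₁ + b₂)   ≤⟨ +-mono-≤ p q ⟩
  (r₁ + b) + (r₂ + b₁)   ≡⟨ solve 4 (λ r₁ r₂ b b₁ → (r₁ :+ b) :+ (r₂ :+ b₁) := (r₁ :+ b₁) :+ (r₂ :+ b)) refl r₁ r₂ b b₁ ⟩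
  (r₁ + b₁) + (r₂ + b)   ∎)
  where
  open ≤-Reasoning
  open +-*-Solver

∸-exchange : ∀ {a b c d} → a + d ≤ c + b → a ∸ b ≤ c ∸ d
∸-exchange {a} {b} {c} {d} p = m≤n+o⇒m∸n≤o a b (+-cancelʳ-≤ d a (b + (c ∸ d)) (begin
  a + d                 ≤⟨ p ⟩
  c + b                 ≡⟨ +-comm c b ⟩
  b + c                 ≤⟨ +-monoʳ-≤ b (m≤n+m∸n c d) ⟩
  b + (d + (c ∸ d))     ≡⟨ cong (b +_) (+-comm d (c ∸ d)) ⟩
  b + ((c ∸ d) + d)     ≡⟨ +-assoc b (c ∸ d) d ⟨
  b + (c ∸ d) + d       ∎))
  where open ≤-Reasoning

-- The hypothesis `d < c` excludes the case that both truncated differences are zero.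
∸-exchange-< : ∀ {a b c d} → a + d < c + b → d < c → a ∸ b < c ∸ d
∸-exchange-< {a} {b} {c} {d} p d<c with b ≤? a
... | yes b≤a = subst (_≤ c ∸ d) (+-∸-assoc 1 b≤a) (∸-exchange {suc a} {b} {c} {d} p)
... | no b≰a = subst (_< c ∸ d) (sym (m≤n⇒m∸n≡0 (<⇒≤ (≰⇒> b≰a)))) (m<n⇒0<n∸m d<c)

shift : ∀ n r r′ b b′ → r + b′ ≤ r′ + b → b′ + n + r ≤ b + n + r′
shift n r r′ b b′ p = begin
  b′ + n + r    ≡⟨ solve 3 (λ b n r → b :+ n :+ r := r :+ b :+ n) refl b′ n r ⟩
  r + b′ + n    ≤⟨ +-monoˡ-≤ n p ⟩
  r′ + b + n    ≡⟨ solve 3 (λ b n r → b :+ n :+ r := r :+ b :+ n) refl b n r′ ⟨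
  b + n + r′    ∎
  where
  open ≤-Reasoning
  open +-*-Solver

length-allFin : ∀ n → length (allFin n) ≡ n
length-allFin n = length-tabulate id

-- Colorings from lists

-- The colors of all lists are merged in one type, each color c belonging to the vertex own c.
module ListColoring {n t size : ℕ} (G : Graph n)
  (own : Fin size → Fin n ⊎ Fin t)
  (_~_ : Fin size → Fin size → Set) (_~?_ : ∀ c x → Dec (c ~ x))
  (~-sym : ∀ {c x} → c ~ x → x ~ c)
  (~-own : ∀ {c x} → c ~ x → own c ≢ own x)
  (~-match : ∀ {c x y} → c ~ x → c ~ y → own x ≡ own y → x ≡ y)
  (~-edge : ∀ {c x u v} → c ~ x → own c ≡ inj₁ u → own x ≡ inj₁ v → Adj G u v)
  where

  C V W : Set
  C = Fin size
  V = Fin n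
  W = Fin n ⊎ Fin t

  _≟ʷ_ : (v w : W) → Dec (v ≡ w)
  _≟ʷ_ = ⊎-≡-dec Fin._≟_ Fin._≟_

  infix 4 _≈_
  _≈_ : C → C → Set
  c ≈ x = c ≡ x ⊎ c ~ x

  _≈?_ : ∀ c x → Dec (c ≈ x)
  c ≈? x = (c Fin.≟ x) ⊎-dec (c ~? x)

  ≈-sym : ∀ {c x} → c ≈ x → x ≈ c
  ≈-sym (inj₁ e) = inj₁ (sym e)
  ≈-sym (inj₂ e) = inj₂ (~-sym e)

  -- A color has no neighbor with its own owner, so closed neighborhoods, like open ones, meet each
  -- list at most once.
  ≈-match : ∀ {c x y} → c ≈ x → c ≈ y → own x ≡ own y → x ≡ y
  ≈-match (inj₁ refl) (inj₁ refl) _ = refl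
  ≈-match (inj₁ refl) (inj₂ c~y) e = ⊥-elim (~-own c~y e)
  ≈-match (inj₂ c~x) (inj₁ refl) e = ⊥-elim (~-own c~x (sym e))
  ≈-match (inj₂ c~x) (inj₂ c~y) e = ~-match c~x c~y e

  ~-irrefl : ∀ {c} → ¬ c ~ c
  ~-irrefl c~c = ~-own c~c refl

  record Lists : Set where
    field
      list   : W → List C
      unique : ∀ w → Unique (list w)
      owned  : ∀ {w c} → c ∈ list w → own c ≡ w

  open Lists

  -- Only neighbors of `c` are deleted. The vertex owning `c` keeps its list; it is dropped
  -- separately from the vertices still to be colored.
  _∖_ : Lists → C → Lists
  list (R ∖ c) w = filter (λ x → ¬? (c ~? x)) (list R w)
  unique (R ∖ c) w = filter⁺ (λ x → ¬? (c ~? x)) (unique R w)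
  owned (R ∖ c) x∈ = owned R (proj₁ (∈-filter⁻ (λ x → ¬? (c ~? x)) x∈))

  ∈-∖⁻ : ∀ R {c w x} → x ∈ list (R ∖ c) w → x ∈ list R w × ¬ c ~ x
  ∈-∖⁻ R {c} = ∈-filter⁻ (λ x → ¬? (c ~? x))

  ∈-∖⁺ : ∀ R {c w x} → x ∈ list R w → ¬ c ~ x → x ∈ list (R ∖ c) w
  ∈-∖⁺ R {c} = ∈-filter⁺ (λ x → ¬? (c ~? x))

  ~-unique : ∀ R {c w} → AtMostOne (c ~_) (list R w)
  ~-unique R x∈ y∈ c~x c~y = ~-match c~x c~y (trans (owned R x∈) (sym (owned R y∈)))

  ≈-unique : ∀ R {c w} → AtMostOne (c ≈_) (list R w)
  ≈-unique R x∈ y∈ c~x c~y = ≈-match c~x c~y (trans (owned R x∈) (sym (owned R y∈)))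

  length-∖ : ∀ R c w → length (list R w) ≤ suc (length (list (R ∖ c) w))
  length-∖ R c w = length-filter-atMostOne (c ~?_) (unique R w) (~-unique R)

  length-∖-unseen : ∀ R {c w} → (∀ {x} → x ∈ list R w → ¬ c ~ x) → length (list (R ∖ c) w) ≡ length (list R w)
  length-∖-unseen R {c} h = cong length (filter-all (λ x → ¬? (c ~? x)) (All.tabulate h))

  -- The function `f` is total for convenience; only its values on `P` matter.
  IsColoring : (W → Set) → Lists → (W → C) → Set
  IsColoring P R f = (∀ {w} → P w → f w ∈ list R w) × (∀ {v w} → P v → P w → ¬ f v ~ f w)

  Coloring : (W → Set) → Lists → Set
  Coloring P R = ∃ (IsColoring P R)

  override : ∀ (f : W → C) w c → ∃ λ g → ∀ v → (v ≡ w × g v ≡ c) ⊎ (g v ≡ f v × v ≢ w)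
  override f w c = (λ v → choose v (v ≟ʷ w)) , λ v → spec v (v ≟ʷ w)
    where
    choose : ∀ v → Dec (v ≡ w) → C
    choose v (yes _) = c
    choose v (no _) = f v
    spec : ∀ v (d : Dec (v ≡ w)) → (v ≡ w × choose v d ≡ c) ⊎ (choose v d ≡ f v × v ≢ w)
    spec v (yes e) = inj₁ (e , refl)
    spec v (no e) = inj₂ (refl , e)

  weaken : ∀ {P P′ : W → Set} R → (∀ {v} → P′ v → P v) → Coloring P R → Coloring P′ R
  weaken R P′⊆P (f , f∈ , indep) = f , f∈ ∘ P′⊆P , λ p q → indep (P′⊆P p) (P′⊆P q)

  adjoin : ∀ {P : W → Set} R {f w c} → IsColoring P R f → c ∈ list R w → (∀ {v} → P v → ¬ c ~ f v) →
    Coloring (λ v → v ≡ w ⊎ P v) R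
  adjoin {P} R {f} {w} {c} (f∈ , indep) c∈ free with g , spec ← override f w c = g , g∈ , g-indep
    where
    P′ = λ v → v ≡ w ⊎ P v
    value : ∀ {v} → P′ v → (v ≡ w × g v ≡ c) ⊎ (g v ≡ f v × P v)
    value {v} p with spec v | p
    ... | inj₁ e | _ = inj₁ e
    ... | inj₂ (_ , ne) | inj₁ e = ⊥-elim (ne e)
    ... | inj₂ (e , _) | inj₂ q = inj₂ (e , q)
    g∈ : ∀ {v} → P′ v → g v ∈ list R v
    g∈ p with value p
    ... | inj₁ (refl , e) rewrite e = c∈
    ... | inj₂ (e , q) rewrite e = f∈ q
    g-indep : ∀ {u v} → P′ u → P′ v → ¬ g u ~ g v
    g-indep p q e with value p | value q
    ... | inj₁ (_ , e₁) | inj₁ (_ , e₂) rewrite e₁ | e₂ = ~-irrefl e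
    ... | inj₁ (_ , e₁) | inj₂ (e₂ , q′) rewrite e₁ | e₂ = free q′ e
    ... | inj₂ (e₁ , p′) | inj₁ (_ , e₂) rewrite e₁ | e₂ = free p′ (~-sym e)
    ... | inj₂ (e₁ , p′) | inj₂ (e₂ , q′) rewrite e₁ | e₂ = indep p′ q′ e

  insert : ∀ {P : W → Set} R {w c} → c ∈ list R w → Coloring P (R ∖ c) → Coloring (λ v → v ≡ w ⊎ P v) R
  insert R c∈ (f , f∈ , indep) =
    adjoin R ((λ p → proj₁ (∈-∖⁻ R (f∈ p))) , indep) c∈ (λ p → proj₂ (∈-∖⁻ R (f∈ p)))

  -- Each vertex colored takes at most one color from every other list. Since `w` comes last, after
  -- all of `vs`, it needs one color more than the others.
  greedy : ∀ vs {w} R → (∀ {v} → v ∈ vs → length vs ≤ length (list R v)) → length vs < length (list R w) →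
    Coloring (_∈ w ∷ vs) R
  greedy [] {w} R _ large with c , c∈ ← inhabited large
    = (λ _ → c) , (λ { (here refl) → c∈ }) , λ _ _ → ~-irrefl
  greedy (v ∷ vs) {w} R h large with c , c∈ ← inhabited (≤-trans (s≤s z≤n) (h (here refl))) =
    weaken R swap (insert R c∈
      (greedy vs (R ∖ c) (λ u∈ → s≤s⁻¹ (≤-trans (h (there u∈)) (length-∖ R c _)))
                         (s≤s⁻¹ (≤-trans large (length-∖ R c w)))))
    where
    swap : ∀ {u} → u ∈ w ∷ v ∷ vs → u ≡ v ⊎ u ∈ w ∷ vs
    swap = λ { (here e) → inj₂ (here e) ; (there (here e)) → inj₁ e ; (there (there u∈)) → inj₂ (there u∈) }

  -- Each vertex already colored blocks at most one color of `w`, and `cand` bounds their number.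
  extend : ∀ {P : W → Set} R {w} cand → Coloring P R → (∀ {v} → P v → v ∈ cand) →
    length cand < length (list R w) → Coloring (λ v → v ≡ w ⊎ P v) R
  extend {P} R {w} cand (f , f∈ , indep) P⊆ large
    with ys , _ , sub , len ← thin _~?_ (map f cand) (unique R w) (λ c → ~-unique R {c})
    with c , c∈ ← inhabited (+-cancelˡ-< (length (map f cand)) 0 (length ys)
           (≤-trans (≤-trans (≤-reflexive (cong suc (trans (+-identityʳ _) (length-map f cand)))) large) len))
    with c∈R , free ← sub c∈
    = adjoin R (f∈ , indep) c∈R λ p e → free (∈-map⁺ f (P⊆ p)) (~-sym e)

  dom : List (Fin t) → List W
  dom B = map inj₂ B ++ map inj₁ (allFin n)

  length-dom : ∀ B → length (dom B) ≡ length B + n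
  length-dom B = trans (length-++ (map inj₂ B))
    (cong₂ _+_ (length-map inj₂ B) (trans (length-map inj₁ (allFin n)) (length-allFin n)))

  ∈-dom₁ : ∀ B {v} → inj₁ v ∈ dom B
  ∈-dom₁ B {v} = ∈-++⁺ʳ (map inj₂ B) (∈-map⁺ inj₁ (∈-allFin v))

  ∈-dom₂ : ∀ {B a} → a ∈ B → inj₂ a ∈ dom B
  ∈-dom₂ a∈ = ∈-++⁺ˡ (∈-map⁺ inj₂ a∈)

  ∈-dom⁻ : ∀ B {a} → inj₂ a ∈ dom B → a ∈ B
  ∈-dom⁻ B p with ∈-++⁻ (map inj₂ B) p
  ... | inj₁ q with _ , a∈ , refl ← ∈-map⁻ inj₂ q = a∈
  ... | inj₂ q with () ← proj₂ (proj₂ (∈-map⁻ inj₁ q))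

  -- There are only `length B + n` vertices in all, so a vertex with more colors than that can wait
  -- until the end.
  extend-all : ∀ {P : W → Set} {B} R vs → Coloring P R → (∀ {w} → P w → w ∈ dom B) →
    (∀ {v} → v ∈ vs → P (inj₁ v) ⊎ length B + n < length (list R (inj₁ v))) →
    Coloring (λ w → P w ⊎ w ∈ map inj₁ vs) R
  extend-all R [] (f , f∈ , indep) P⊆ h =
    f , (λ { (inj₁ p) → f∈ p }) , λ { (inj₁ p) (inj₁ q) → indep p q }
  extend-all {P} {B} R (v ∷ vs) S P⊆ h with h (here refl) | extend-all {B = B} R vs S P⊆ (h ∘ there)
  ... | inj₁ p | S′ = weaken R old S′
    where
    old : ∀ {w} → P w ⊎ w ∈ map inj₁ (v ∷ vs) → P w ⊎ w ∈ map inj₁ vs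
    old (inj₁ q) = inj₁ q
    old (inj₂ (here refl)) = inj₁ p
    old (inj₂ (there q)) = inj₂ q
  ... | inj₂ large | S′ =
    weaken R split (extend R (dom B) S′ covered (subst (_< _) (sym (length-dom B)) large))
    where
    covered : ∀ {w} → P w ⊎ w ∈ map inj₁ vs → w ∈ dom B
    covered (inj₁ p) = P⊆ p
    covered (inj₂ q) with _ , _ , refl ← ∈-map⁻ inj₁ q = ∈-dom₁ B
    split : ∀ {w} → P w ⊎ w ∈ map inj₁ (v ∷ vs) → w ≡ inj₁ v ⊎ (P w ⊎ w ∈ map inj₁ vs)
    split (inj₁ q) = inj₂ (inj₁ q)
    split (inj₂ (here e)) = inj₁ e
    split (inj₂ (there q)) = inj₂ (inj₂ q)

  remove : Fin t → List (Fin t) → List (Fin t)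
  remove a = filter (λ b → ¬? (b Fin.≟ a))

  length-remove : ∀ {a B} → Unique B → a ∈ B → length B ≡ suc (length (remove a B))
  length-remove {a} {B} u a∈ = ≤-antisym
    (length-filter-atMostOne (Fin._≟ a) u λ { _ _ refl refl → refl })
    (filter-notAll (λ b → ¬? (b Fin.≟ a)) B (lose a∈ λ ne → ne refl))

  dom-remove : ∀ {a B w} → w ∈ dom B → w ≡ inj₂ a ⊎ w ∈ dom (remove a B)
  dom-remove {a} {B} {inj₁ v} _ = inj₂ (∈-dom₁ (remove a B))
  dom-remove {a} {B} {inj₂ b} w∈ with b Fin.≟ a
  ... | yes refl = inj₁ refl
  ... | no ne = inj₂ (∈-dom₂ (∈-filter⁺ (λ b → ¬? (b Fin.≟ a)) (∈-dom⁻ B w∈) ne))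

  -- The vertices of B get colors outside the closed neighborhoods of the κ colors s i; a₀ is
  -- colored last, which is why it alone needs a full list.
  place : ∀ {κ} (R R′ : Lists) {B a₀} → Unique B → a₀ ∈ B →
    (∀ {w x} → x ∈ list R′ w → x ∈ list R w) →
    (s : Fin κ → C) →
    (∀ w → κ + length B ≤ suc (length (list R′ w))) →
    κ + length B ≤ length (list R′ (inj₂ a₀)) →
    (Label : V → C → Set) →
    (∀ v → (∃ λ x → x ∈ list R (inj₁ v) × Label v x) ⊎ length B + n < length (list R (inj₁ v))) →
    (∀ {v x a c} → Label v x → x ∈ list R (inj₁ v) → a ∈ B → c ∈ list R′ (inj₂ a) → c ~ x → ∃ λ i → s i ≈ c) →
    (∀ {u v x y} → Label u x → Label v y → x ∈ list R (inj₁ u) → y ∈ list R (inj₁ v) → ¬ x ~ y) →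
    Coloring (_∈ dom B) R
  place {κ} R R′ {B} {a₀} uB a₀∈ sub s large large₀ Label choice shield separate =
    weaken R (λ { {inj₁ v} _ → inj₂ (∈-map⁺ inj₁ (∈-allFin v)) ; {inj₂ a} w∈ → inj₁ (∈-dom⁻ B w∈) })
      (extend-all {B = B} R (allFin n) (h , (λ {w} → h∈ w) , λ {v} {w} → h-indep v w)
        (λ { {inj₁ v} _ → ∈-dom₁ B ; {inj₂ a} a∈ → ∈-dom₂ a∈ })
        (λ {v} _ → picked v (choice v)))
    where
    thinned : ∀ w → _
    thinned w = thin (λ i c → s i ≈? c) (allFin κ) (unique R′ w) (λ i → ≈-unique R′)
    R° : Lists
    list R° w = proj₁ (thinned w)
    unique R° w = proj₁ (proj₂ (thinned w))
    owned R° {w} c∈ = owned R′ (proj₁ (proj₁ (proj₂ (proj₂ (thinned w))) c∈))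
    rest = remove a₀ B
    length-R° : ∀ w → length (list R′ w) ≤ κ + length (list R° w)
    length-R° w = subst (λ k → length (list R′ w) ≤ k + length (list R° w)) (length-allFin κ)
      (proj₂ (proj₂ (proj₂ (thinned w))))
    length-rest : length (map inj₂ rest) ≡ length rest
    length-rest = length-map {B = W} inj₂ rest
    -- A list of `R′` may be one color short of `κ + length B`, but `rest` has one vertex fewer than
    -- `B`.
    on-rest : ∀ w → length (map inj₂ rest) ≤ length (list R° w)
    on-rest w = s≤s⁻¹ (+-cancelˡ-≤ κ _ _ (begin
      κ + suc (length (map inj₂ rest)) ≡⟨ cong (λ k → κ + suc k) length-rest ⟩
      κ + suc (length rest)            ≡⟨ cong (κ +_) (length-remove uB a₀∈) ⟨
      κ + length B                     ≤⟨ large w ⟩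
      suc (length (list R′ w))         ≤⟨ s≤s (length-R° w) ⟩
      suc (κ + length (list R° w))     ≡⟨ +-suc κ _ ⟨
      κ + suc (length (list R° w))     ∎))
      where open ≤-Reasoning
    on-a₀ : length (map inj₂ rest) < length (list R° (inj₂ a₀))
    on-a₀ = +-cancelˡ-≤ κ _ _ (begin
      κ + suc (length (map inj₂ rest))  ≡⟨ cong (λ k → κ + suc k) length-rest ⟩
      κ + suc (length rest)             ≡⟨ cong (κ +_) (length-remove uB a₀∈) ⟨
      κ + length B                      ≤⟨ large₀ ⟩
      length (list R′ (inj₂ a₀))        ≤⟨ length-R° (inj₂ a₀) ⟩
      κ + length (list R° (inj₂ a₀))    ∎)
      where open ≤-Reasoning
    on-B : Coloring (_∈ inj₂ a₀ ∷ map inj₂ rest) R°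
    on-B = greedy (map inj₂ rest) R° (λ {w} _ → on-rest w) on-a₀
    g = proj₁ on-B
    covered : ∀ {a} → a ∈ B → inj₂ a ∈ inj₂ a₀ ∷ map inj₂ rest
    covered a∈ with dom-remove {a₀} (∈-dom₂ a∈)
    ... | inj₁ e = here e
    ... | inj₂ w∈ = there (∈-map⁺ inj₂ (∈-dom⁻ rest w∈))
    g∈ : ∀ {a} → a ∈ B → g (inj₂ a) ∈ list R° (inj₂ a)
    g∈ a∈ = proj₁ (proj₂ on-B) (covered a∈)
    g∈′ : ∀ {a} → a ∈ B → g (inj₂ a) ∈ list R′ (inj₂ a) × (∀ i → ¬ s i ≈ g (inj₂ a))
    g∈′ {a} a∈ with p , q ← proj₁ (proj₂ (proj₂ (thinned (inj₂ a)))) (g∈ a∈) = p , λ i → q (∈-allFin i)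
    Picked : ∀ v → (∃ λ x → x ∈ list R (inj₁ v) × Label v x) ⊎ length B + n < length (list R (inj₁ v)) → Set
    Picked v ch = ∃ λ p → ch ≡ inj₁ p
    pick : ∀ v → (∃ λ x → x ∈ list R (inj₁ v) × Label v x) ⊎ length B + n < length (list R (inj₁ v)) → C
    pick v (inj₁ (x , _)) = x
    pick v (inj₂ _) = g (inj₁ v)
    picked : ∀ v ch → Picked v ch ⊎ length B + n < length (list R (inj₁ v))
    picked v (inj₁ p) = inj₁ (p , refl)
    picked v (inj₂ d) = inj₂ d
    pick-spec : ∀ v ch → Picked v ch → pick v ch ∈ list R (inj₁ v) × Label v (pick v ch)
    pick-spec v _ ((x , x∈ , l) , refl) = x∈ , l
    -- The vertices of `G` outside `P` have long lists and are left to `extend-all`.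
    P : W → Set
    P (inj₁ v) = Picked v (choice v)
    P (inj₂ a) = a ∈ B
    h : W → C
    h (inj₁ v) = pick v (choice v)
    h (inj₂ a) = g (inj₂ a)
    h∈ : ∀ w → P w → h w ∈ list R w
    h∈ (inj₁ v) p = proj₁ (pick-spec v (choice v) p)
    h∈ (inj₂ a) a∈ = sub (proj₁ (g∈′ a∈))
    -- By `shield`, a color at `a` adjacent to a picked color would lie in the closed neighborhood
    -- of some `s i`, and such colors were removed.
    mixed : ∀ {a v} → a ∈ B → Picked v (choice v) → ¬ h (inj₂ a) ~ h (inj₁ v)
    mixed {a} {v} a∈ p e with x∈ , l ← pick-spec v (choice v) p
      with i , si≈ ← shield l x∈ a∈ (proj₁ (g∈′ a∈)) e = proj₂ (g∈′ a∈) i si≈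
    h-indep : ∀ v w → P v → P w → ¬ h v ~ h w
    h-indep (inj₁ u) (inj₁ v) p q with x∈ , l ← pick-spec u (choice u) p | y∈ , l′ ← pick-spec v (choice v) q
      = separate l l′ x∈ y∈
    h-indep (inj₁ u) (inj₂ a) p q e = mixed q p (~-sym e)
    h-indep (inj₂ a) (inj₁ v) p q e = mixed p q e
    h-indep (inj₂ a) (inj₂ b) p q = proj₂ (proj₂ on-B) (covered p) (covered q)

  -- Stuck vertices and labels without conflicts

  record Stuck (R : Lists) (B : List (Fin t)) (v : V) : Set where
    field
      sees  : ∀ {a c} → a ∈ B → c ∈ list R (inj₂ a) → ∃ λ x → x ∈ list R (inj₁ v) × c ~ x
      agree : ∀ {a a′ c c′ x} → a ∈ B → a′ ∈ B → c ∈ list R (inj₂ a) → c′ ∈ list R (inj₂ a′) →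
              x ∈ list R (inj₁ v) → c ~ x → c′ ~ x → c ≈ c′

  open Stuck

  -- Two colors of the label vertex conflict when their copies at some u and v are adjacent.
  Conflict : Lists → V × V → C → C → Set
  Conflict R (u , v) c c′ =
    Any (λ x → c ~ x × Any (λ y → x ~ y × y ~ c′) (list R (inj₁ v))) (list R (inj₁ u))

  conflict? : ∀ R uv c c′ → Dec (Conflict R uv c c′)
  conflict? R (u , v) c c′ = Any.any? (λ x → (c ~? x) ×-dec Any.any? (λ y → (x ~? y) ×-dec (y ~? c′)) _) _

  conflict-intro : ∀ R {u v c c′ x y} → x ∈ list R (inj₁ u) → y ∈ list R (inj₁ v) →
    c ~ x → x ~ y → c′ ~ y → Conflict R (u , v) c c′
  conflict-intro R x∈ y∈ e₁ e₂ e₃ = lose x∈ (e₁ , lose y∈ (e₂ , ~-sym e₃))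

  conflict-sym : ∀ R {u v c c′} → Conflict R (u , v) c c′ → Conflict R (v , u) c′ c
  conflict-sym R p with x , x∈ , e₁ , q ← find p with y , y∈ , e₂ , e₃ ← find q
    = lose y∈ (~-sym e₃ , lose x∈ (~-sym e₂ , ~-sym e₁))

  -- Three matchings in a row: the first color determines `x`, then `x` determines `y`, and `y`
  -- determines the last color.
  conflict-unique : ∀ R {uv c w} → AtMostOne (Conflict R uv c) (list R w)
  conflict-unique R c₁∈ c₂∈ p q
    with x , x∈ , e₁ , p′ ← find p with y , y∈ , e₂ , e₃ ← find p′
    with x′ , x′∈ , d₁ , q′ ← find q with y′ , y′∈ , d₂ , d₃ ← find q′
    with refl ← ~-unique R x∈ x′∈ e₁ d₁ with refl ← ~-unique R y∈ y′∈ e₂ d₂ = ~-unique R c₁∈ c₂∈ e₃ d₃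

  pairs : List (V × V)
  pairs = cartesianProduct (allFin n) (allFin n)

  module _ (R : Lists) (w : W) where

    Independent : ∀ {κ} → (Fin κ → C) → Set
    Independent s = ∀ {i j} uv → i ≢ j → ¬ Conflict R uv (s i) (s j)

    -- Each pair of vertices of `G` rules out at most one color as conflicting with `y`; with `y`
    -- itself this makes `suc (length pairs)` colors per label. The first label is prescribed so
    -- that `missing-label` can put `i₀` there.
    independent-cons : ∀ κ {y ys} → Unique ys → (∀ {c} → c ∈ ys → c ∈ list R w) →
      length pairs + κ * suc (length pairs) ≤ length ys →
      ∃ λ (s : Fin (suc κ) → C) → s zero ≡ y × (∀ i → s (suc i) ∈ ys) × Independent s
    independent : ∀ κ {ys} → Unique ys → (∀ {c} → c ∈ ys → c ∈ list R w) →
      κ * suc (length pairs) ≤ length ys →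
      ∃ λ (s : Fin κ → C) → (∀ i → s i ∈ ys) × Independent s

    independent-cons κ {y} {ys} u ys⊆ large
      with zs , uzs , sub , len ← thin (λ uv → conflict? R uv y) pairs u
             (λ uv p q → conflict-unique R (ys⊆ p) (ys⊆ q))
      with s , s∈ , ind ← independent κ uzs (ys⊆ ∘ proj₁ ∘ sub)
             (+-cancelˡ-≤ (length pairs) _ _ (≤-trans large len))
      = s′ , refl , (λ i → proj₁ (sub (s∈ i))) , ind′
      where
      s′ : Fin (suc κ) → C
      s′ zero = y
      s′ (suc i) = s i
      ind′ : Independent s′
      ind′ {zero} {zero} uv ne = ⊥-elim (ne refl)
      ind′ {zero} {suc j} (u , v) _ = proj₂ (sub (s∈ j)) (∈-cartesianProduct⁺ (∈-allFin u) (∈-allFin v))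
      -- All ordered pairs were used in thinning, so a conflict in the other direction is excluded
      -- at the reversed pair.
      ind′ {suc i} {zero} (u , v) _ p =
        proj₂ (sub (s∈ i)) (∈-cartesianProduct⁺ (∈-allFin v) (∈-allFin u)) (conflict-sym R p)
      ind′ {suc i} {suc j} uv ne = ind uv (ne ∘ cong suc)

    independent zero u ys⊆ large = (λ ()) , (λ ()) , λ { {()} }
    independent (suc κ) {y ∷ ys} (_ ∷ u) ys⊆ (s≤s large)
      with s , e , s∈ , ind ← independent-cons κ {y} u (ys⊆ ∘ there) large
      = s , (λ { zero → here e ; (suc i) → there (s∈ i) }) , λ {i} {j} → ind {i} {j}

  -- Partial colorings and savings

  record State (κ : ℕ) : Set where
    field
      B     : List (Fin t)
      B!    : Unique B
      R     : Lists
      large : ∀ w → κ + length B ≤ length (list R w)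

  open State

  Solvable : ∀ {κ} → State κ → Set
  Solvable S = Coloring (_∈ dom (B S)) (R S)

  step : ∀ {κ} (S : State κ) {a c} → a ∈ B S → c ∈ list (R S) (inj₂ a) → State κ
  B (step S {a} _ _) = remove a (B S)
  B! (step S {a} _ _) = filter⁺ (λ b → ¬? (b Fin.≟ a)) (B! S)
  R (step S {c = c} _ _) = R S ∖ c
  -- One vertex leaves `B`, and each list loses at most one color.
  large (step {κ} S {a} {c} a∈ c∈) w = s≤s⁻¹ (begin
    suc (κ + length (remove a (B S)))     ≡⟨ +-suc κ _ ⟨
    κ + suc (length (remove a (B S)))     ≡⟨ cong (κ +_) (length-remove (B! S) a∈) ⟨
    κ + length (B S)                      ≤⟨ large S w ⟩
    length (list (R S) w)                 ≤⟨ length-∖ (R S) c w ⟩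
    suc (length (list (R S ∖ c) w))       ∎)
    where open ≤-Reasoning

  solvable-step : ∀ {κ} (S : State κ) {a c} (a∈ : a ∈ B S) (c∈ : c ∈ list (R S) (inj₂ a)) →
    Solvable (step S a∈ c∈) → Solvable S
  solvable-step S a∈ c∈ sol = weaken (R S) dom-remove (insert (R S) c∈ sol)

  -- gain says that |R w| − |B| does not decrease.
  record _⟶_ {κ} (S S′ : State κ) : Set where
    field
      lift  : Solvable S′ → Solvable S
      gain  : ∀ w → length (list (R S) w) + length (B S′) ≤ length (list (R S′) w) + length (B S)
      short : length (B S) ≤ 2 + length (B S′)

  open _⟶_

  -- The second component is `gain` at `v` with strict inequality: the difference between list
  -- length and `length (B S)` grows.
  Saves : ∀ {κ} → State κ → V → State κ → Set
  Saves S v S′ = S ⟶ S′ ×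
    length (list (R S) (inj₁ v)) + length (B S′) < length (list (R S′) (inj₁ v)) + length (B S)

  Saved : ∀ {κ} → State κ → V → Set
  Saved S v = ∃ (Saves S v)

  gain-step : ∀ {κ} (S : State κ) {a c} (a∈ : a ∈ B S) (c∈ : c ∈ list (R S) (inj₂ a)) w →
    length (list (R S) w) + length (remove a (B S)) ≤ length (list (R S ∖ c) w) + length (B S)
  gain-step S {a} {c} a∈ c∈ w = begin
    length (list (R S) w) + length (remove a (B S))           ≤⟨ +-monoˡ-≤ _ (length-∖ (R S) c w) ⟩
    suc (length (list (R S ∖ c) w)) + length (remove a (B S)) ≡⟨ +-suc _ _ ⟨
    length (list (R S ∖ c) w) + suc (length (remove a (B S))) ≡⟨ cong (length (list (R S ∖ c) w) +_) (length-remove (B! S) a∈) ⟨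
    length (list (R S ∖ c) w) + length (B S)                  ∎
    where open ≤-Reasoning

  -- The list of `v` keeps its length while `B` loses a vertex.
  save-unseen : ∀ {κ} (S : State κ) {v a c} → a ∈ B S → c ∈ list (R S) (inj₂ a) →
    (∀ {x} → x ∈ list (R S) (inj₁ v) → ¬ c ~ x) → Saved S v
  save-unseen S {v} {a} {c} a∈ c∈ unseen = step S a∈ c∈ , record
    { lift = solvable-step S a∈ c∈
    ; gain = gain-step S a∈ c∈
    ; short = ≤-trans (≤-reflexive (length-remove (B! S) a∈)) (n≤1+n _)
    } , ≤-reflexive (trans (sym (+-suc _ _))
          (cong₂ _+_ (sym (length-∖-unseen (R S) unseen)) (sym (length-remove (B! S) a∈))))

  -- Once c is used, its neighbor x is gone, so that c′ has no neighbor left in the list of v.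
  save-common : ∀ {κ} (S : State κ) {v a a′ c c′ x} → a ∈ B S → a′ ∈ B S →
    c ∈ list (R S) (inj₂ a) → c′ ∈ list (R S) (inj₂ a′) → x ∈ list (R S) (inj₁ v) →
    c ~ x → c′ ~ x → ¬ c ≈ c′ → Saved S v
  save-common S {v} {a} {a′} {c} {c′} {x} a∈ a′∈ c∈ c′∈ x∈ c~x c′~x c≉c′ =
    S₂ , record
      { lift = solvable-step S a∈ c∈ ∘ solvable-step S₁ a′∈₁ c′∈₁
      ; gain = λ w → exchange {length (list (R S) w)} (gain-step S a∈ c∈ w) (gain-step S₁ a′∈₁ c′∈₁ w)
      ; short = ≤-reflexive (trans (length-remove (B! S) a∈) (cong suc (length-remove (B! S₁) a′∈₁)))
      } , exchange {suc (length (list (R S) (inj₁ v)))} (s≤s (gain-step S a∈ c∈ (inj₁ v)))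
            (proj₂ (proj₂ (save-unseen S₁ a′∈₁ c′∈₁ unseen)))
    where
    S₁ = step S a∈ c∈
    a′≢a : a′ ≢ a
    a′≢a refl = c≉c′ (inj₁ (~-unique (R S) c∈ c′∈ (~-sym c~x) (~-sym c′~x)))
    a′∈₁ : a′ ∈ B S₁
    a′∈₁ = ∈-filter⁺ (λ b → ¬? (b Fin.≟ a)) a′∈ a′≢a
    c′∈₁ : c′ ∈ list (R S₁) (inj₂ a′)
    c′∈₁ = ∈-∖⁺ (R S) c′∈ (c≉c′ ∘ inj₂)
    S₂ = step S₁ a′∈₁ c′∈₁
    unseen : ∀ {y} → y ∈ list (R S₁) (inj₁ v) → ¬ c′ ~ y
    unseen y∈ c′~y with y∈R , c≁y ← ∈-∖⁻ (R S) y∈ with refl ← ~-unique (R S) x∈ y∈R c′~x c′~y = c≁y c~x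

  -- The fields of `Stuck` are the negations of the two ways to save. A failure of `sees` is handled
  -- by `save-unseen`, a failure of `agree` by `save-common`, and there are only finitely many
  -- places to look.
  saved-or-stuck : ∀ {κ} (S : State κ) v → Saved S v ⊎ Stuck (R S) (B S) v
  saved-or-stuck S v = combine sees? agree?
    where
    Rv = list (R S) (inj₁ v)
    sees? : Saved S v ⊎ (∀ {a} → a ∈ B S → ∀ {c} → c ∈ list (R S) (inj₂ a) → ∃ λ x → x ∈ Rv × c ~ x)
    sees? = either-all _ λ a∈ → either-all _ λ {c} c∈ →
      -- In the inner search the first alternative is a neighbor of `c`, the second that there is
      -- none; only the latter is a saving, hence the swap.
      Sum.map (save-unseen S a∈ c∈) id (Sum.swap (either-all Rv λ {x} x∈ → seen x∈ (c ~? x)))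
      where
      seen : ∀ {c x} → x ∈ Rv → Dec (c ~ x) → (∃ λ x → x ∈ Rv × c ~ x) ⊎ ¬ c ~ x
      seen x∈ (yes e) = inj₁ (_ , x∈ , e)
      seen x∈ (no ne) = inj₂ ne
    agree? : Saved S v ⊎ (∀ {a} → a ∈ B S → ∀ {a′} → a′ ∈ B S → ∀ {c} → c ∈ list (R S) (inj₂ a) →
      ∀ {c′} → c′ ∈ list (R S) (inj₂ a′) → ∀ {x} → x ∈ Rv → c ~ x → c′ ~ x → c ≈ c′)
    agree? = either-all _ λ a∈ → either-all _ λ a′∈ → either-all _ λ {c} c∈ → either-all _ λ {c′} c′∈ →
      either-all Rv λ {x} x∈ → agreed a∈ a′∈ c∈ c′∈ x∈ (c ~? x) (c′ ~? x) (c ≈? c′)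
      where
      agreed : ∀ {a a′ c c′ x} → a ∈ B S → a′ ∈ B S → c ∈ list (R S) (inj₂ a) → c′ ∈ list (R S) (inj₂ a′) →
        x ∈ Rv → Dec (c ~ x) → Dec (c′ ~ x) → Dec (c ≈ c′) → Saved S v ⊎ (c ~ x → c′ ~ x → c ≈ c′)
      agreed _ _ _ _ _ (no ne) _ _ = inj₂ λ e → ⊥-elim (ne e)
      agreed _ _ _ _ _ (yes _) (no ne) _ = inj₂ λ _ e → ⊥-elim (ne e)
      agreed _ _ _ _ _ (yes _) (yes _) (yes e) = inj₂ λ _ _ → e
      agreed a∈ a′∈ c∈ c′∈ x∈ (yes e) (yes e′) (no ne) = inj₁ (save-common S a∈ a′∈ c∈ c′∈ x∈ e e′ ne)
    combine : _ → _ → Saved S v ⊎ Stuck (R S) (B S) v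
    combine (inj₁ s) _ = inj₁ s
    combine (inj₂ _) (inj₁ s) = inj₁ s
    combine (inj₂ q) (inj₂ r) = inj₂ record
      { sees = λ a∈ → q a∈ ; agree = λ a∈ a′∈ c∈ c′∈ x∈ → r a∈ a′∈ c∈ c′∈ x∈ }

  -- Coloring with a surplus at one vertex

  solve-single : (S : State 0) (v₀ : V) → (∀ v → v ≡ v₀) → length (B S) < length (list (R S) (inj₁ v₀)) → Solvable S
  solve-single S v₀ only large₀ = weaken (R S) covered
    -- The vertex `v₀` comes last, where its extra color is required.
    (greedy (map inj₂ (B S)) (R S) (λ {w} _ → ≤-trans (≤-reflexive (length-map inj₂ (B S))) (large S w))
      (subst (_< length (list (R S) (inj₁ v₀))) (sym (length-map inj₂ (B S))) large₀))
    where
    covered : ∀ {w} → w ∈ dom (B S) → w ∈ inj₁ v₀ ∷ map inj₂ (B S)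
    covered {inj₁ v} _ = here (cong inj₁ (only v))
    covered {inj₂ a} w∈ = there (∈-map⁺ inj₂ (∈-dom⁻ (B S) w∈))

  -- If `a₀` has more than `κ + length (B S)` colors, it can afford to lose one, and any color of
  -- `v₀` will do. Otherwise the list of `v₀` is longer than that of `a₀`, so some color in it has
  -- no neighbor there.
  surplus : ∀ {κ} (S : State κ) {v₀} a₀ → κ + length (B S) < length (list (R S) (inj₁ v₀)) →
    ∃ λ x → x ∈ list (R S) (inj₁ v₀) × κ + length (B S) ≤ length (list (R S ∖ x) (inj₂ a₀))
  surplus {κ} S {v₀} a₀ slack with length (list (R S) (inj₂ a₀)) ≤? κ + length (B S)
  ... | no ≰ with x , x∈ ← inhabited (≤-trans (s≤s z≤n) slack)
    = x , x∈ , s≤s⁻¹ (≤-trans (≰⇒> ≰) (length-∖ (R S) x (inj₂ a₀)))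
  surplus {κ} S {v₀} a₀ slack | yes ≤q
    with ys , _ , sub , len ← thin _~?_ (list (R S) (inj₂ a₀)) (unique (R S) (inj₁ v₀)) (λ c → ~-unique (R S) {c})
    with x , x∈ ← inhabited (+-cancelˡ-≤ (length (list (R S) (inj₂ a₀))) 1 (length ys)
           (≤-trans (≤-reflexive (+-comm _ 1)) (≤-trans (s≤s ≤q) (≤-trans slack len))))
    with x∈R , unseen ← sub x∈
    = x , x∈R , ≤-trans (large S (inj₂ a₀))
                  (≤-reflexive (sym (length-∖-unseen (R S) λ c∈ x~c → unseen c∈ (~-sym x~c))))

  -- The analogue of `Conflict` for a color `x` that is used itself and not through a label.
  Near : Lists → C → V → C → Set
  Near R x v c = Any (λ y → x ~ y × y ~ c) (list R (inj₁ v))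

  -- For each of the `n` vertices `v` at most one color of `w` is near `x₀`. These are discarded
  -- first, and the labels are chosen from the rest.
  independent-avoiding : ∀ R {w} κ x₀ → n + κ * suc (length pairs) ≤ length (list R w) →
    ∃ λ (s : Fin κ → C) → (∀ i → s i ∈ list R w) × Independent R w s × (∀ i v → ¬ Near R x₀ v (s i))
  independent-avoiding R {w} κ x₀ enough
    with ys , uys , sub , len ← thin {Q = Near R x₀} (λ v c → Any.any? (λ y → (x₀ ~? y) ×-dec (y ~? c)) _)
           (allFin n) (unique R w)
           (λ v c∈ d∈ p q → let y , y∈ , e , f = find p ; z , z∈ , g , h = find q in
              ~-unique R c∈ d∈ f (subst (_~ _) (sym (~-unique R y∈ z∈ e g)) h))
    with s , s∈ , ind ← independent R w κ uys (proj₁ ∘ sub) (+-cancelˡ-≤ n _ _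
           (≤-trans enough (subst (λ k → length (list R w) ≤ k + length ys) (length-allFin n) len)))
    = s , proj₁ ∘ sub ∘ s∈ , (λ {i} {j} → ind {i} {j}) , λ i v → proj₂ (sub (s∈ i)) (∈-allFin v)

  module _ {κ : ℕ} (v₀ : V) (col : V → Fin (suc κ))
    (proper : ∀ {u v} → u ≢ v₀ → v ≢ v₀ → Adj G u v → col u ≢ col v) where

    reserve : ℕ
    reserve = n + suc κ * suc (length pairs)

    Classified : State (suc κ) → V → Set
    Classified S v = v ≡ v₀ ⊎ length (B S) + n < length (list (R S) (inj₁ v)) ⊎ Stuck (R S) (B S) v

    -- v₀ gets a color x₀ taken from its surplus, every other stuck vertex v the copy of s (col v).
    finish : (S : State (suc κ)) → suc κ + length (B S) < length (list (R S) (inj₁ v₀)) →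
      reserve ≤ length (B S) → (∀ v → Classified S v) → Solvable S
    finish S slack enough classified
      with a₀ , a₀∈ ← inhabited {xs = B S} (≤-trans (s≤s z≤n) (≤-trans (m≤n+m _ n) enough))
      with x₀ , x₀∈ , large₀ ← surplus S a₀ slack
      with s , s∈ , ind , far ← independent-avoiding (R S) {inj₂ a₀} (suc κ) x₀
             (≤-trans enough (≤-trans (m≤n+m _ (suc κ)) (large S (inj₂ a₀))))
      -- The neighbors of `x₀` are deleted before `B` is colored. A list may thus end one color
      -- short, but the choice of `x₀` keeps that of `a₀` long enough.
      = place (R S) (R S ∖ x₀) (B! S) a₀∈ (proj₁ ∘ ∈-∖⁻ (R S)) s
          (λ w → ≤-trans (large S w) (length-∖ (R S) x₀ w)) large₀ Label (λ v → choice (classified v)) shield separate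
      where
      Label : V → C → Set
      Label v x = (v ≡ v₀ × x ≡ x₀) ⊎ (v ≢ v₀ × Stuck (R S) (B S) v × s (col v) ~ x)
      choice : ∀ {v} → Classified S v →
        (∃ λ x → x ∈ list (R S) (inj₁ v) × Label v x) ⊎ length (B S) + n < length (list (R S) (inj₁ v))
      choice {v} cl with v Fin.≟ v₀ | cl
      ... | yes refl | _ = inj₁ (x₀ , x₀∈ , inj₁ (refl , refl))
      ... | no v≢ | inj₁ v≡ = ⊥-elim (v≢ v≡)
      ... | no v≢ | inj₂ (inj₁ done) = inj₂ done
      ... | no v≢ | inj₂ (inj₂ st) with x , x∈ , e ← sees st a₀∈ (s∈ (col v)) = inj₁ (x , x∈ , inj₂ (v≢ , st , e))
      shield : ∀ {v x a c} → Label v x → x ∈ list (R S) (inj₁ v) → a ∈ B S →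
        c ∈ list (R S ∖ x₀) (inj₂ a) → c ~ x → ∃ λ i → s i ≈ c
      shield (inj₁ (refl , refl)) _ _ c∈ e = ⊥-elim (proj₂ (∈-∖⁻ (R S) c∈) (~-sym e))
      shield {v} (inj₂ (_ , st , e′)) x∈ a∈ c∈ e =
        col v , agree st a₀∈ a∈ (s∈ (col v)) (proj₁ (∈-∖⁻ (R S) c∈)) x∈ e′ e
      separate : ∀ {u v x y} → Label u x → Label v y → x ∈ list (R S) (inj₁ u) → y ∈ list (R S) (inj₁ v) → ¬ x ~ y
      separate (inj₁ (refl , refl)) (inj₁ (refl , refl)) _ _ e = ~-irrefl e
      -- A copy adjacent to `x₀` would make its label near `x₀`.
      separate {v = v} (inj₁ (refl , refl)) (inj₂ (_ , _ , f)) _ y∈ e = far (col v) v (lose y∈ (e , ~-sym f))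
      separate {u} (inj₂ (_ , _ , f)) (inj₁ (refl , refl)) x∈ _ e = far (col u) u (lose x∈ (~-sym e , ~-sym f))
      separate {u} {v} (inj₂ (u≢ , _ , f)) (inj₂ (v≢ , _ , g)) x∈ y∈ e =
        ind (u , v) (proper u≢ v≢ (~-edge e (owned (R S) x∈) (owned (R S) y∈))) (conflict-intro (R S) x∈ y∈ f e g)

    -- An upper bound on the savings `v` needs before it may wait until the end: zero exactly when
    -- its list has more than `length (B S) + n` colors.
    deficit : State (suc κ) → V → ℕ
    deficit S v = suc (length (B S) + n) ∸ length (list (R S) (inj₁ v))

    -- Every saving at a vertex that cannot wait yet lowers the total deficit and uses at most two
    -- vertices of `B`. So `2 * δ` vertices pay for all savings, and `reserve` remains for `finish`.
    run : ∀ δ (S : State (suc κ)) → suc κ + length (B S) < length (list (R S) (inj₁ v₀)) →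
      sum (map (deficit S) (allFin n)) ≤ δ → 2 * δ + reserve ≤ length (B S) → Solvable S
    run δ S slack bound enough = continue (either-all (allFin n) λ {v} _ → classify v)
      where
      Progress : Set
      Progress = ∃ λ v → Saved S v × ¬ length (B S) + n < length (list (R S) (inj₁ v))
      classify : ∀ v → Progress ⊎ Classified S v
      classify v with v Fin.≟ v₀ | length (B S) + n <? length (list (R S) (inj₁ v)) | saved-or-stuck S v
      ... | yes e | _ | _ = inj₂ (inj₁ e)
      ... | no _ | yes done | _ = inj₂ (inj₂ (inj₁ done))
      ... | no _ | no _ | inj₂ st = inj₂ (inj₂ (inj₂ st))
      ... | no _ | no ¬done | inj₁ saved = inj₁ (v , saved , ¬done)
      continue : Progress ⊎ (∀ {v} → v ∈ allFin n → Classified S v) → Solvable S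
      continue (inj₂ cl) = finish S slack (≤-trans (m≤n+m reserve (2 * δ)) enough) (λ v → cl (∈-allFin v))
      continue (inj₁ (v , (S′ , S⟶S′ , strict) , ¬done)) = lift S⟶S′ (rest δ enough (≤-trans decrease bound))
        where
        mono : ∀ u → deficit S′ u ≤ deficit S u
        mono u = ∸-exchange {b = length (list (R S′) (inj₁ u))} {d = length (list (R S) (inj₁ u))}
          (s≤s (shift n (length (list (R S) (inj₁ u))) _ (length (B S)) (length (B S′)) (gain S⟶S′ (inj₁ u))))
        strict′ : deficit S′ v < deficit S v
        strict′ = ∸-exchange-< {b = length (list (R S′) (inj₁ v))} {d = length (list (R S) (inj₁ v))}
          (s≤s (≤-trans (≤-reflexive (sym (+-suc _ _)))
            (shift n (suc (length (list (R S) (inj₁ v)))) _ (length (B S)) (length (B S′)) strict)))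
          (s≤s (≮⇒≥ ¬done))
        decrease : sum (map (deficit S′) (allFin n)) < sum (map (deficit S) (allFin n))
        decrease = sum-map-strict (∈-allFin v) mono strict′
        slack′ : suc κ + length (B S′) < length (list (R S′) (inj₁ v₀))
        slack′ = subst (_ ≤_) (+-identityʳ _)
          (exchange {suc (suc κ)} {b = 0} (≤-trans slack (≤-reflexive (sym (+-identityʳ _)))) (gain S⟶S′ (inj₁ v₀)))
        -- The strict decrease forces `δ` to be a successor, and the two vertices so released pay
        -- for this saving.
        rest : ∀ δ → 2 * δ + reserve ≤ length (B S) → sum (map (deficit S′) (allFin n)) < δ → Solvable S′
        rest (suc δ) enough (s≤s bound) = run δ S′ slack′ bound (s≤s⁻¹ (s≤s⁻¹
          (≤-trans (≤-reflexive (sym (cong (_+ reserve) (*-suc 2 δ)))) (≤-trans enough (short S⟶S′)))))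

    deficit-≤ : ∀ S v → deficit S v ≤ suc n
    deficit-≤ S v = m≤n+o⇒m∸n≤o _ (length (list (R S) (inj₁ v))) (begin
      suc (length (B S) + n)                      ≡⟨ +-suc (length (B S)) n ⟨
      length (B S) + suc n                        ≤⟨ +-monoˡ-≤ (suc n) (≤-trans (m≤n+m _ (suc κ)) (large S (inj₁ v))) ⟩
      length (list (R S) (inj₁ v)) + suc n        ∎)
      where open ≤-Reasoning

    solve-slack : (S : State (suc κ)) → suc κ + length (B S) < length (list (R S) (inj₁ v₀)) →
      2 * (n * suc n) + reserve ≤ length (B S) → Solvable S
    solve-slack S slack = run (n * suc n) S slack (≤-trans (sum-map-≤ (allFin n) (deficit-≤ S))
      (≤-reflexive (cong (_* suc n) (length-allFin n))))

  -- Consistent labels when every vertex is stuck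

  module _ {κ : ℕ} (S : State κ) (everything : ∀ a → a ∈ B S)
    (balanced : ∀ v w → length (list (R S) v) ≡ length (list (R S) w))
    (stuck : ∀ v → Stuck (R S) (B S) v) (a₀ : Fin t) where

    private
      L : W → List C
      L = list (R S)

      agreement : ∀ {a a′ v c c′ x} → c ∈ L (inj₂ a) → c′ ∈ L (inj₂ a′) → x ∈ L (inj₁ v) → c ~ x → c′ ~ x → c ≈ c′
      agreement {a} {a′} {v} = agree (stuck v) (everything a) (everything a′)

      forth : ∀ {a c} v → c ∈ L (inj₂ a) → ∃ λ x → x ∈ L (inj₁ v) × c ~ x
      forth {a} v = sees (stuck v) (everything a)

    -- The matching from L a into L v is onto because both lists have the same length.
    back : ∀ {v x} a → x ∈ L (inj₁ v) → ∃ λ c → c ∈ L (inj₂ a) × c ~ x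
    back {v} {x} a x∈
      with ys , _ , sub , len ← thin _~?_ (filter (λ y → ¬? (y Fin.≟ x)) (L (inj₁ v))) (unique (R S) (inj₂ a)) (λ c → ~-unique (R S) {c})
      with c , c∈ ← inhabited (+-cancelˡ-≤ (length (filter (λ y → ¬? (y Fin.≟ x)) (L (inj₁ v)))) 1 (length ys)
             (≤-trans (≤-reflexive (+-comm _ 1))
               (≤-trans (filter-notAll (λ y → ¬? (y Fin.≟ x)) _ (lose x∈ λ ne → ne refl))
                 (≤-trans (≤-reflexive (balanced (inj₁ v) (inj₂ a))) len))))
      with c∈a , unseen ← sub c∈ with y , y∈ , c~y ← forth v c∈a with y Fin.≟ x
    ... | yes refl = c , c∈a , c~y
    ... | no y≢x = ⊥-elim (unseen (∈-filter⁺ (λ y → ¬? (y Fin.≟ x)) y∈ y≢x) (~-sym c~y))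

    -- The colors `c₀` and `x₀` of `a₀` are the labels of `c` and `x`. If `c ~ x`, then `c` and `x₀`
    -- share the neighbor `x`, hence agree. Conversely, the neighbor of `x` in the list of `a`,
    -- given by `back`, has the label of `c` and so is `c`.
    joined-AV : ∀ {a v c x c₀ x₀} → c ∈ L (inj₂ a) → x ∈ L (inj₁ v) → c₀ ∈ L (inj₂ a₀) → x₀ ∈ L (inj₂ a₀) →
      c ≈ c₀ → x ≈ x₀ → (c ~ x → c₀ ≡ x₀) × (c₀ ≡ x₀ → c ~ x)
    joined-AV {a} {v} {c} {x} c∈ x∈ c₀∈ x₀∈ c≈c₀ x≈x₀ = to , from
      where
      x₀~x : ∀ {x₀} → x₀ ∈ L (inj₂ a₀) → x ≈ x₀ → x₀ ~ x
      x₀~x x₀∈ (inj₁ refl) with () ← trans (sym (owned (R S) x₀∈)) (owned (R S) x∈)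
      x₀~x x₀∈ (inj₂ e) = ~-sym e
      to : c ~ x → _
      to c~x = ≈-unique (R S) c₀∈ x₀∈ c≈c₀ (agreement c∈ x₀∈ x∈ c~x (x₀~x x₀∈ x≈x₀))
      from : _ → c ~ x
      from refl with c′ , c′∈ , c′~x ← back a x∈
        with refl ← ≈-unique (R S) c∈ c′∈ (≈-sym c≈c₀) (agreement x₀∈ c′∈ x∈ (x₀~x x₀∈ x≈x₀) c′~x) = c′~x

    -- Routed through a vertex `v` of `G`: if `x` is the neighbor of `c` in the list of `v`, then
    -- both sides are equivalent to `d ~ x`.
    joined-AA : ∀ {a b c d c₀ d₀} → V → a ≢ b → c ∈ L (inj₂ a) → d ∈ L (inj₂ b) → c₀ ∈ L (inj₂ a₀) → d₀ ∈ L (inj₂ a₀) →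
      c ≈ c₀ → d ≈ d₀ → (c ~ d → c₀ ≡ d₀) × (c₀ ≡ d₀ → c ~ d)
    joined-AA {a} {b} {c} {d} {c₀} {d₀} v a≢b c∈ d∈ c₀∈ d₀∈ c≈c₀ d≈d₀
      with x , x∈ , c~x ← forth v c∈ with x₀ , x₀∈ , x₀~x ← back a₀ x∈ = to , from
      where
      x≈x₀ = inj₂ (~-sym x₀~x)
      c₀≡x₀ = proj₁ (joined-AV c∈ x∈ c₀∈ x₀∈ c≈c₀ x≈x₀) c~x
      to : c ~ d → c₀ ≡ d₀
      to c~d with d′ , d′∈ , d′~x ← back b x∈
        with refl ← ≈-unique (R S) d∈ d′∈ (inj₂ c~d) (agreement c∈ d′∈ x∈ c~x d′~x)
        = trans c₀≡x₀ (sym (proj₁ (joined-AV d∈ x∈ d₀∈ x₀∈ d≈d₀ x≈x₀) d′~x))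
      from : c₀ ≡ d₀ → c ~ d
      from e with agreement c∈ d∈ x∈ c~x (proj₂ (joined-AV d∈ x∈ d₀∈ x₀∈ d≈d₀ x≈x₀) (trans (sym e) c₀≡x₀))
      ... | inj₂ c~d = c~d
      ... | inj₁ refl = ⊥-elim (a≢b (inj₂-injective (trans (sym (owned (R S) c∈)) (owned (R S) d∈))))

    -- A color of `K t` gets its label through a vertex of `G`. A color of `a₀` is its own label,
    -- which is why labels are compared by `≈` and not by `~`.
    label : ∀ {w c} → V → c ∈ L w → ∃ λ c₀ → c₀ ∈ L (inj₂ a₀) × c ≈ c₀
    label {inj₁ v} _ c∈ with c₀ , c₀∈ , e ← back a₀ c∈ = c₀ , c₀∈ , inj₂ (~-sym e)
    label {inj₂ a} v c∈ with x , x∈ , c~x ← forth v c∈ with c₀ , c₀∈ , c₀~x ← back a₀ x∈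
      = c₀ , c₀∈ , agreement c∈ c₀∈ x∈ c~x c₀~x

    unlabel : ∀ {c₀} → V → c₀ ∈ L (inj₂ a₀) → ∀ w → ∃ λ c → c ∈ L w × c ≈ c₀
    unlabel _ c₀∈ (inj₁ v) with x , x∈ , e ← forth v c₀∈ = x , x∈ , inj₂ (~-sym e)
    unlabel v c₀∈ (inj₂ a) with x , x∈ , c₀~x ← forth v c₀∈ with c , c∈ , c~x ← back a x∈
      = c , c∈ , agreement c∈ c₀∈ x∈ c~x c₀~x

    -- Stuckness concerns only edges that meet `K t`; for edges of `G` the assumption `full` gives
    -- one direction, and with the matching property also the other.
    joined : (∀ {u v i x y} → Adj G u v → i ∈ L (inj₂ a₀) → x ∈ L (inj₁ u) → y ∈ L (inj₁ v) → i ~ x → i ~ y → x ~ y) →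
      V → ∀ {w w′ c c′ c₀ c₀′} → JoinAdj G (K t) w w′ → c ∈ L w → c′ ∈ L w′ → c₀ ∈ L (inj₂ a₀) → c₀′ ∈ L (inj₂ a₀) →
      c ≈ c₀ → c′ ≈ c₀′ → (c ~ c′ → c₀ ≡ c₀′) × (c₀ ≡ c₀′ → c ~ c′)
    joined full v₀ {inj₁ u} {inj₁ v} {c} {c′} {c₀} {c₀′} uv c∈ c′∈ c₀∈ c₀′∈ p q = to , from
      where
      label~ : ∀ {v c c₀} → c ∈ L (inj₁ v) → c₀ ∈ L (inj₂ a₀) → c ≈ c₀ → c₀ ~ c
      label~ c∈ c₀∈ (inj₁ refl) with () ← trans (sym (owned (R S) c₀∈)) (owned (R S) c∈)
      label~ _ _ (inj₂ e) = ~-sym e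
      from : c₀ ≡ c₀′ → c ~ c′
      from refl = full uv c₀∈ c∈ c′∈ (label~ c∈ c₀∈ p) (label~ c′∈ c₀∈ q)
      to : c ~ c′ → c₀ ≡ c₀′
      to c~c′ with d , d∈ , c₀~d ← forth v c₀∈
        with refl ← ~-unique (R S) c′∈ d∈ c~c′ (full uv c₀∈ c∈ d∈ (label~ c∈ c₀∈ p) c₀~d)
        = ~-unique (R S) c₀∈ c₀′∈ (~-sym c₀~d) (~-sym (label~ c′∈ c₀′∈ q))
    joined full v₀ {inj₁ u} {inj₂ a} _ c∈ c′∈ c₀∈ c₀′∈ p q with to , from ← joined-AV c′∈ c∈ c₀′∈ c₀∈ q p
      = sym ∘ to ∘ ~-sym , ~-sym ∘ from ∘ sym
    joined full v₀ {inj₂ a} {inj₁ v} _ c∈ c′∈ c₀∈ c₀′∈ p q = joined-AV c∈ c′∈ c₀∈ c₀′∈ p q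
    joined full v₀ {inj₂ a} {inj₂ b} a≢b c∈ c′∈ c₀∈ c₀′∈ p q = joined-AA v₀ a≢b c∈ c′∈ c₀∈ c₀′∈ p q

  -- If the label i₀ is missing from the matching on the edge uv, then u and v can share it.
  missing-label : ∀ {κ} (S : State (suc κ)) → (∀ v → Stuck (R S) (B S) v) → ∀ {a₀ u v i₀ x y} → a₀ ∈ B S →
    length pairs + κ * suc (length pairs) ≤ length (B S) →
    (col : V → Fin (suc κ)) → col u ≡ zero → col v ≡ zero →
    (∀ {u′ v′} → Adj G u′ v′ → col u′ ≡ col v′ → (u′ ≡ u × v′ ≡ v) ⊎ (u′ ≡ v × v′ ≡ u)) →
    i₀ ∈ list (R S) (inj₂ a₀) → x ∈ list (R S) (inj₁ u) → y ∈ list (R S) (inj₁ v) →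
    i₀ ~ x → i₀ ~ y → ¬ x ~ y → Solvable S
  missing-label {κ} S stuck {a₀} {u} {v} {i₀} {x} {y} a₀∈ enough col col-u col-v only i₀∈ x∈ y∈ i₀~x i₀~y x≁y
    -- The missing label is assigned to color zero, the common color of `u` and `v`.
    with s , refl , s∈ , ind ← independent-cons (R S) (inj₂ a₀) κ {i₀} (unique (R S) (inj₂ a₀)) id
           (≤-trans enough (≤-trans (m≤n+m _ (suc κ)) (large S (inj₂ a₀))))
    = place (R S) (R S) (B! S) a₀∈ id s (λ w → m≤n⇒m≤1+n (large S w)) (large S (inj₂ a₀)) Label choice shield separate
    where
    s∈′ : ∀ i → s i ∈ list (R S) (inj₂ a₀)
    s∈′ zero = i₀∈
    s∈′ (suc i) = s∈ i
    Label : V → C → Set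
    Label w z = s (col w) ~ z
    choice : ∀ w → (∃ λ z → z ∈ list (R S) (inj₁ w) × Label w z) ⊎ length (B S) + n < length (list (R S) (inj₁ w))
    choice w = inj₁ (sees (stuck w) a₀∈ (s∈′ (col w)))
    shield : ∀ {w z a c} → Label w z → z ∈ list (R S) (inj₁ w) → a ∈ B S → c ∈ list (R S) (inj₂ a) → c ~ z → ∃ λ i → s i ≈ c
    shield {w} l z∈ a∈ c∈ e = col w , agree (stuck w) a₀∈ a∈ (s∈′ (col w)) c∈ z∈ l e
    uv-only : ∀ {z z′} → s (col u) ~ z → s (col v) ~ z′ → z ∈ list (R S) (inj₁ u) → z′ ∈ list (R S) (inj₁ v) → ¬ z ~ z′
    uv-only f g z∈ z′∈ e rewrite col-u | col-v
      with refl ← ~-unique (R S) z∈ x∈ f i₀~x with refl ← ~-unique (R S) z′∈ y∈ g i₀~y = x≁y e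
    separate : ∀ {u v x y} → Label u x → Label v y → x ∈ list (R S) (inj₁ u) → y ∈ list (R S) (inj₁ v) → ¬ x ~ y
    separate {u′} {v′} f g z∈ z′∈ e with col u′ Fin.≟ col v′
    ... | no ne = ind (u′ , v′) ne (conflict-intro (R S) z∈ z′∈ f e g)
    ... | yes same with only (~-edge e (owned (R S) z∈) (owned (R S) z′∈)) same
    ...   | inj₁ (refl , refl) = uv-only f g z∈ z′∈ e
    ...   | inj₂ (refl , refl) = uv-only g f z′∈ z∈ (~-sym e)

-- Covers of joins

-- Stated for a general `f` because the tail of `tabulate f` is `tabulate (f ∘ suc)`; only the
-- identity is used in the end.
length-filter-∈ : ∀ {M N} (p : Subset N) (q : Subset M) (f : Fin N → Fin M) →
  (∀ i → i ∈ˢ p → f i ∈ˢ q) → (∀ i → f i ∈ˢ q → i ∈ˢ p) → length (filter (_∈? q) (tabulate f)) ≡ ∣ p ∣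
length-filter-∈ [] q f to from = refl
length-filter-∈ (inside ∷ p) q f to from with f zero ∈? q
... | yes _ = cong suc (length-filter-∈ p q (f ∘ suc) (λ i i∈ → to (suc i) (Vec.there i∈)) (λ i i∈ → drop-there (from (suc i) i∈)))
... | no z∉ = ⊥-elim (z∉ (to zero Vec.here))
length-filter-∈ (outside ∷ p) q f to from with f zero ∈? q
... | no _ = length-filter-∈ p q (f ∘ suc) (λ i i∈ → to (suc i) (Vec.there i∈)) (λ i i∈ → drop-there (from (suc i) i∈))
... | yes z∈ with () ← from zero z∈

∣∣≡length : ∀ {N} (p : Subset N) → length (filter (_∈? p) (allFin N)) ≡ ∣ p ∣
∣∣≡length p = length-filter-∈ p p id (λ _ → id) (λ _ → id)

lookup-injective : ∀ {A : Set} {xs : List A} → Unique xs → ∀ {i j} → lookup xs i ≡ lookup xs j → i ≡ j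
lookup-injective (_ ∷ _) {zero} {zero} _ = refl
lookup-injective (x∉ ∷ _) {zero} {suc j} e = ⊥-elim (All.lookup x∉ (∈-lookup j) e)
lookup-injective (x∉ ∷ _) {suc i} {zero} e = ⊥-elim (All.lookup x∉ (∈-lookup i) (sym e))
lookup-injective (_ ∷ u) {suc i} {suc j} e = cong suc (lookup-injective u e)

module FromCover {n t : ℕ} (G : Graph n) (𝓗 : Cover (G ∨ᴳ K t)) where
  open Cover 𝓗

  vertex : Fin size → Fin (n + t)
  vertex c = proj₁ (union c)

  vertex-unique : ∀ {c v} → c ∈ˢ L v → vertex c ≡ v
  vertex-unique {c} {v} c∈ with vertex c Fin.≟ v
  ... | yes e = e
  ... | no ne = ⊥-elim (disjoint ne (proj₂ (union c)) c∈)

  own : Fin size → Fin n ⊎ Fin t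
  own c = splitAt n (vertex c)

  own-vertex : ∀ {c w} → own c ≡ w → c ∈ˢ L (join n t w)
  own-vertex {c} refl = subst (λ v → c ∈ˢ L v) (sym (FinP.join-splitAt n t (vertex c))) (proj₂ (union c))

  vertex-own : ∀ {c w} → c ∈ˢ L (join n t w) → own c ≡ w
  vertex-own {c} {w} c∈ = trans (cong (splitAt n) (vertex-unique c∈)) (FinP.splitAt-join n t w)

  separated : ∀ {c x} → Adj H c x → own c ≢ own x
  separated {c} {x} e same = independent (own-vertex {c} refl) (own-vertex {x} (sym same)) e

  vertex-separated : ∀ {c x} → Adj H c x → vertex c ≢ vertex x
  vertex-separated e = separated e ∘ cong (splitAt n)

  matched : ∀ {c x y} → Adj H c x → Adj H c y → own x ≡ own y → x ≡ y
  matched {c} {x} {y} e f same = proj₁ (proj₂ (cross (vertex-separated e) (c , x , edge))) edge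
    (proj₂ (union c) , subst (λ v → y ∈ˢ L v) y-vertex (proj₂ (union y)) , f)
    where
    edge = proj₂ (union c) , proj₂ (union x) , e
    y-vertex : vertex y ≡ vertex x
    y-vertex = trans (sym (FinP.join-splitAt n t (vertex y))) (trans (cong (join n t) (sym same)) (FinP.join-splitAt n t (vertex x)))

  edge-below : ∀ {c x u v} → Adj H c x → own c ≡ inj₁ u → own x ≡ inj₁ v → Adj G u v
  edge-below {c} {x} e p q = subst₂ (JoinAdj G (K t)) p q
    (proj₁ (cross (vertex-separated e) (c , x , proj₂ (union c) , proj₂ (union x) , e)))

  open ListColoring {n} {t} {size} G own (Adj H) (adj? H) (symmetric H) separated matched edge-below public

  open Lists
  open State

  covered : Lists
  list covered w = filter (_∈? L (join n t w)) (allFin size)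
  unique covered w = filter⁺ (_∈? L (join n t w)) (allFin⁺ size)
  owned covered {w} c∈ = vertex-own (proj₂ (∈-filter⁻ (_∈? L (join n t w)) {xs = allFin size} c∈))

  ∈-covered : ∀ {c w} → own c ≡ w → c ∈ list covered w
  ∈-covered {c} {w} e = ∈-filter⁺ (_∈? L (join n t w)) (∈-allFin c) (own-vertex e)

  module _ {κ : ℕ} (fold : IsFold 𝓗 (κ + t)) where

    length-covered : ∀ w → length (list covered w) ≡ κ + t
    length-covered w = trans (∣∣≡length (L (join n t w))) (fold (join n t w))

    initial : State κ
    B initial = allFin t
    B! initial = allFin⁺ t
    R initial = covered
    large initial w = ≤-reflexive (trans (cong (κ +_) (length-allFin t)) (sym (length-covered w)))

    -- The transversal consists of the colors that `f` gives to their own vertices.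
    solvable⇒proper : Solvable initial → ∃ (IsProperColoring 𝓗)
    solvable⇒proper (f , f∈ , indep) = T , T-indep , transversal
      where
      all-dom : ∀ w → w ∈ dom (allFin t)
      all-dom (inj₁ v) = ∈-dom₁ (allFin t)
      all-dom (inj₂ a) = ∈-dom₂ (∈-allFin a)
      chosen? : ∀ c → Dec (f (own c) ≡ c)
      chosen? c = f (own c) Fin.≟ c
      T : Subset size
      T = Vec.tabulate (does ∘ chosen?)
      ∈T⁺ : ∀ {c} → f (own c) ≡ c → c ∈ˢ T
      ∈T⁺ {c} e = Vec.lookup⇒[]= c T (trans (Vec.lookup∘tabulate _ c) (dec-true (chosen? c) e))
      ∈T⁻ : ∀ {c} → c ∈ˢ T → f (own c) ≡ c
      ∈T⁻ {c} c∈ with chosen? c | trans (sym (Vec.lookup∘tabulate (does ∘ chosen?) c)) (Vec.[]=⇒lookup c∈)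
      ... | yes e | _ = e
      T-indep : ∀ {c c′} → c ∈ˢ T → c′ ∈ˢ T → ¬ Adj H c c′
      T-indep {c} {c′} c∈ c′∈ e =
        indep (all-dom (own c)) (all-dom (own c′)) (subst₂ (Adj H) (sym (∈T⁻ c∈)) (sym (∈T⁻ c′∈)) e)
      transversal : ∀ v → ∃! _≡_ (λ c → c ∈ˢ T × c ∈ˢ L v)
      transversal v = f w , (∈T⁺ (cong f own-f) , subst (λ v → f w ∈ˢ L v) (FinP.join-splitAt n t v) (own-vertex own-f)) ,
        λ {y} (y∈T , y∈L) → trans (cong (f ∘ splitAt n) (sym (vertex-unique y∈L))) (∈T⁻ y∈T)
        where
        w = splitAt n v
        own-f : own (f w) ≡ w
        own-f = owned covered (f∈ (all-dom w))

  canonical-empty : IsFold 𝓗 0 → Canonical 𝓗 0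
  canonical-empty fold = fold , (λ c → ⊥-elim (none (proj₂ (union c)))) ,
    (λ v → (λ {x} → ⊥-elim (none (proj₂ x))) , λ ()) , λ u v _ c _ c∈ → ⊥-elim (none c∈)
    where
    none : ∀ {c v} → ¬ c ∈ˢ L v
    none {c} {v} c∈ with filter (_∈? L v) (allFin size) | trans (∣∣≡length (L v)) (fold v) | ∈-filter⁺ (_∈? L v) (∈-allFin c) c∈
    ... | [] | _ | ()
    ... | _ ∷ _ | () | _

  -- The label of a color is the position in the list of `a₀` of its mate, the only color there in
  -- its closed neighborhood.
  stuck⇒canonical : ∀ {κ} (fold : IsFold 𝓗 (κ + t)) → Fin n → (a₀ : Fin t) →
    (∀ v → Stuck covered (allFin t) v) →
    (∀ {u v i x y} → Adj G u v → i ∈ list covered (inj₂ a₀) → x ∈ list covered (inj₁ u) → y ∈ list covered (inj₁ v) →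
      Adj H i x → Adj H i y → Adj H x y) →
    Canonical 𝓗 (κ + t)
  stuck⇒canonical {κ} fold v₀ a₀ stuck full = fold , lab , bijective , λ u v e c c′ c∈ c′∈ → adjacency e c∈ c′∈
    where
    S = initial fold
    M = list covered (inj₂ a₀)
    length-M : length M ≡ κ + t
    length-M = length-covered fold (inj₂ a₀)
    all-B : ∀ a → a ∈ allFin t
    all-B = ∈-allFin
    balanced : ∀ v w → length (list covered v) ≡ length (list covered w)
    balanced v w = trans (length-covered fold v) (sym (length-covered fold w))
    labelled : ∀ c → ∃ λ c₀ → c₀ ∈ M × c ≈ c₀
    labelled c = label S all-B balanced stuck a₀ {own c} v₀ (∈-covered {c} refl)
    mate : Fin size → Fin size
    mate c = proj₁ (labelled c)
    mate∈ : ∀ c → mate c ∈ M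
    mate∈ c = proj₁ (proj₂ (labelled c))
    mate≈ : ∀ c → c ≈ mate c
    mate≈ c = proj₂ (proj₂ (labelled c))
    index : ∀ c → Fin (length M)
    index c = Any.index (mate∈ c)
    lab : Fin size → Fin (κ + t)
    lab c = Fin.cast length-M (index c)
    lab-injective : ∀ {c c′} → lab c ≡ lab c′ → mate c ≡ mate c′
    lab-injective {c} {c′} e = trans (lookup-index (mate∈ c)) (trans (cong (lookup M) same) (sym (lookup-index (mate∈ c′))))
      where
      same : index c ≡ index c′
      same = FinP.toℕ-injective (trans (sym (FinP.toℕ-cast length-M (index c))) (trans (cong Fin.toℕ e) (FinP.toℕ-cast length-M (index c′))))
    lab-cong : ∀ {c c′} → mate c ≡ mate c′ → lab c ≡ lab c′
    lab-cong {c} {c′} e = cong (Fin.cast length-M) (lookup-injective (unique covered (inj₂ a₀))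
      (trans (sym (lookup-index (mate∈ c))) (trans e (lookup-index (mate∈ c′)))))
    bijective : ∀ v → Bijective _≡_ _≡_ (λ (x : ∃ (_∈ˢ L v)) → lab (proj₁ x))
    bijective v = injective , surjective
      where
      injective : ∀ {x y : ∃ (_∈ˢ L v)} → lab (proj₁ x) ≡ lab (proj₁ y) → x ≡ y
      injective {x , x∈} {y , y∈} e with same ← lab-injective {x} {y} e
        -- Two colors of `v` in the closed neighborhood of the same mate coincide.
        with refl ← ≈-match {mate x} (≈-sym (mate≈ x)) (subst (_≈ y) (sym same) (≈-sym (mate≈ y)))
               (cong (splitAt n) (trans (vertex-unique x∈) (sym (vertex-unique y∈))))
        = cong (x ,_) ([]=-irrelevant x∈ y∈)
      surjective : ∀ i → ∃ λ x → ∀ {z : ∃ (_∈ˢ L v)} → z ≡ x → lab (proj₁ z) ≡ i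
      -- Read `i` as a position in the list of `a₀`; `unlabel` carries the color there to a color of
      -- `v`.
      surjective i with i₀ ← Fin.cast (sym length-M) i in i₀-def
        with c , c∈ , c≈ ← unlabel S all-B balanced stuck a₀ v₀ (∈-lookup {xs = M} i₀) (splitAt n v)
        = (c , subst (λ v → c ∈ˢ L v) (FinP.join-splitAt n t v) (own-vertex (owned covered {splitAt n v} c∈))) , λ { refl → labelled-i }
        where
        mate-c : mate c ≡ lookup M i₀
        mate-c = ≈-unique covered {c} {inj₂ a₀} (mate∈ c) (∈-lookup i₀) (mate≈ c) c≈
        labelled-i : lab c ≡ i
        labelled-i = trans (cong (Fin.cast length-M) (lookup-injective (unique covered (inj₂ a₀))
          (trans (sym (lookup-index (mate∈ c))) mate-c)))
          (trans (cong (Fin.cast length-M) (sym i₀-def)) (FinP.cast-involutive length-M (sym length-M) i))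
    adjacency : ∀ {u v c c′} → JoinAdj G (K t) (splitAt n u) (splitAt n v) → c ∈ˢ L u → c′ ∈ˢ L v → Adj H c c′ ⇔ lab c ≡ lab c′
    adjacency {u} {v} {c} {c′} e c∈ c′∈ with to , from ← joined S all-B balanced stuck a₀ full v₀ {own c} {own c′}
        (subst₂ (λ u v → JoinAdj G (K t) (splitAt n u) (splitAt n v)) (sym (vertex-unique c∈)) (sym (vertex-unique c′∈)) e)
        (∈-covered {c} refl) (∈-covered {c′} refl) (mate∈ c) (mate∈ c′) (mate≈ c) (mate≈ c′)
      = mk⇔ (lab-cong {c} {c′} ∘ to) (from ∘ lab-injective {c} {c′})

-- Minimal uncolorability and bad covers

length-cartesianProduct : ∀ {A B : Set} (xs : List A) (ys : List B) →
  length (cartesianProduct xs ys) ≡ length xs * length ys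
length-cartesianProduct [] ys = refl
length-cartesianProduct (x ∷ xs) ys = trans (length-++ (map (x ,_) ys))
  (cong₂ _+_ (length-map (x ,_) ys) (length-cartesianProduct xs ys))

-- Criticality in terms of `κ = k − 1` colors, tested only on `G` minus a vertex or an edge. The
-- coloring in `minus-vertex` takes a proof of `v ≢ v₀` because for `κ = 0` no color could be given
-- to `v₀`. That in `minus-edge` colors all of `G`, with at most `uv` monochromatic.
record MinimallyUncolorable {n} (κ : ℕ) (G : Graph n) : Set where
  field
    uncolorable : ¬ Colorable (Adj G) κ
    minus-vertex : ∀ v₀ → ∃ λ (f : ∀ v → v ≢ v₀ → Fin κ) → ∀ {u v} p q → Adj G u v → f u p ≢ f v q
    minus-edge : ∀ {u v} → Adj G u v → ∃ λ (f : Fin n → Fin κ) →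
      ∀ {u′ v′} → Adj G u′ v′ → f u′ ≡ f v′ → (u′ ≡ u × v′ ≡ v) ⊎ (u′ ≡ v × v′ ≡ u)

open MinimallyUncolorable public

-- Two vertices of K t for the first saving, two for each of the at most n (n + 1) others,
-- and the rest for the choice of κ labels without conflicts.
bound : ℕ → ℕ → ℕ
bound n κ = 2 + (2 * (n * suc n) + (n + κ * suc (n * n)))

module _ {n : ℕ} {G : Graph n} where

  minus-vertex-total : ∀ {κ} → MinimallyUncolorable (suc κ) G → ∀ v₀ → ∃ λ (f : Fin n → Fin (suc κ)) →
    ∀ {u v} → u ≢ v₀ → v ≢ v₀ → Adj G u v → f u ≢ f v
  minus-vertex-total {κ} G-min v₀ with f , proper ← minus-vertex G-min v₀ = g , g-proper
    where
    g : Fin n → Fin (suc κ)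
    g v with v Fin.≟ v₀
    ... | yes _ = zero
    ... | no v≢ = f v v≢
    g-proper : ∀ {u v} → u ≢ v₀ → v ≢ v₀ → Adj G u v → g u ≢ g v
    g-proper {u} {v} u≢ v≢ uv with u Fin.≟ v₀ | v Fin.≟ v₀
    ... | yes u≡ | _ = ⊥-elim (u≢ u≡)
    ... | no _ | yes v≡ = ⊥-elim (v≢ v≡)
    ... | no p | no q = proper p q uv

  -- If `u` and `v` had different colors, the coloring would be proper on `G`. A transposition moves
  -- their common color to zero.
  minus-edge-zero : ∀ {κ} → MinimallyUncolorable (suc κ) G → ∀ {u v} → Adj G u v → ∃ λ (f : Fin n → Fin (suc κ)) →
    f u ≡ zero × f v ≡ zero ×
    (∀ {u′ v′} → Adj G u′ v′ → f u′ ≡ f v′ → (u′ ≡ u × v′ ≡ v) ⊎ (u′ ≡ v × v′ ≡ u))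
  minus-edge-zero {κ} G-min {u} {v} uv with f , only ← minus-edge G-min uv = g , g-u , trans (cong swap (sym same)) g-u ,
      λ e p → only e (swap-injective p)
    where
    swap : Fin (suc κ) → Fin (suc κ)
    swap = Components.transpose (f u) zero
    swap-injective : ∀ {i j} → swap i ≡ swap j → i ≡ j
    swap-injective p = trans (sym (Components.transpose-inverse zero (f u)))
      (trans (cong (Components.transpose zero (f u)) p) (Components.transpose-inverse zero (f u)))
    g : Fin n → Fin (suc κ)
    g = swap ∘ f
    g-u : g u ≡ zero
    g-u with f u Fin.≟ f u
    ... | yes _ = refl
    ... | no ne = ⊥-elim (ne refl)
    same : f u ≡ f v
    same with f u Fin.≟ f v
    ... | yes e = e
    ... | no ne = ⊥-elim (uncolorable G-min (f , proper))
      where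
      proper : ∀ {u′ v′} → Adj G u′ v′ → f u′ ≢ f v′
      proper e p with only e p
      ... | inj₁ (refl , refl) = ne p
      ... | inj₂ (refl , refl) = ne (sym p)

  module _ {t : ℕ} (v* : Fin n) (𝓗 : Cover (G ∨ᴳ K t)) (bad : Bad 𝓗) where
    open FromCover G 𝓗
    open State
    open Lists
    open _⟶_

    -- The vertex starts with at least `κ + length (B S)` colors by `large`, and the saving adds the
    -- surplus.
    slack-after : ∀ {κ} (S : State κ) {v S′} → Saves S v S′ → κ + length (B S′) < length (list (R S′) (inj₁ v))
    slack-after {κ} S {v} {S′} (_ , strict) = subst (_ ≤_) (+-identityʳ _)
      (exchange {suc κ} {suc (length (list (R S) (inj₁ v)))} {b = 0} {b₁ = length (B S)}
        (≤-trans (s≤s (large S (inj₁ v))) (≤-reflexive (sym (+-identityʳ _)))) strict)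

    dichotomy : ∀ {κ} (S : State κ) → (∃ λ v → Saved S v) ⊎ (∀ v → Stuck (R S) (B S) v)
    dichotomy S = Sum.map id (λ stuck v → stuck (∈-allFin v))
      (either-all (allFin n) λ {v} _ → Sum.map (v ,_) id (saved-or-stuck S v))

    length-pairs : length pairs ≡ n * n
    length-pairs = trans (length-cartesianProduct (allFin n) (allFin n)) (cong₂ _*_ (length-allFin n) (length-allFin n))

    -- A coloring of `G − v₀` with no colors shows that `v₀` is the only vertex; one of `G − uv`
    -- shows that there are no edges.
    bad⇒canonical-single : MinimallyUncolorable 0 G → IsFold 𝓗 t → Fin t → Canonical 𝓗 t
    bad⇒canonical-single G-min fold a₀ with dichotomy (initial {0} fold)
    ... | inj₁ (v₀ , S′ , saves) = ⊥-elim (bad (solvable⇒proper {0} fold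
          (lift (proj₁ saves) (solve-single S′ v₀ only (slack-after (initial {0} fold) saves)))))
      where
      only : ∀ v → v ≡ v₀
      only v with v Fin.≟ v₀
      ... | yes e = e
      ... | no ne with () ← proj₁ (minus-vertex G-min v₀) v ne
    ... | inj₂ stuck = stuck⇒canonical {0} fold v* a₀ stuck λ {u} {v} uv → ⊥-elim (no-edge uv)
      where
      no-edge : ∀ {u v} → ¬ Adj G u v
      no-edge {u} uv with () ← proj₁ (minus-edge G-min uv) u

    bad⇒canonical-large : ∀ κ → MinimallyUncolorable (suc κ) G → IsFold 𝓗 (suc κ + t) → bound n (suc κ) ≤ t → Fin t →
      Canonical 𝓗 (suc κ + t)
    bad⇒canonical-large κ G-min fold big a₀ with dichotomy S₀
      where S₀ = initial {suc κ} fold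
    ... | inj₁ (v₀ , S′ , saves) = ⊥-elim (bad (solvable⇒proper {suc κ} fold
          (lift (proj₁ saves) (solve-slack v₀ (proj₁ col) (proj₂ col) S′ (slack-after (initial {suc κ} fold) saves) enough))))
      where
      col = minus-vertex-total G-min v₀
      enough : 2 * (n * suc n) + (n + suc κ * suc (length pairs)) ≤ length (B S′)
      enough = subst (λ p → 2 * (n * suc n) + (n + suc κ * suc p) ≤ length (B S′)) (sym length-pairs)
        (s≤s⁻¹ (s≤s⁻¹ (≤-trans big (≤-trans (≤-reflexive (sym (length-allFin t))) (short (proj₁ saves))))))
    ... | inj₂ stuck = stuck⇒canonical {suc κ} fold v* a₀ stuck full
      where
      enough : length pairs + κ * suc (length pairs) ≤ length (allFin t)
      enough = begin
        length pairs + κ * suc (length pairs)  ≤⟨ n≤1+n _ ⟩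
        suc κ * suc (length pairs)             ≡⟨ cong (λ p → suc κ * suc p) length-pairs ⟩
        suc κ * suc (n * n)                    ≤⟨ m≤n+m _ n ⟩
        n + suc κ * suc (n * n)                ≤⟨ m≤n+m _ (2 + 2 * (n * suc n)) ⟩
        bound n (suc κ)                        ≤⟨ big ⟩
        t                                      ≡⟨ length-allFin t ⟨
        length (allFin t)                      ∎
        where open ≤-Reasoning
      full : ∀ {u v i x y} → Adj G u v → i ∈ list covered (inj₂ a₀) → x ∈ list covered (inj₁ u) → y ∈ list covered (inj₁ v) →
        Adj (Cover.H 𝓗) i x → Adj (Cover.H 𝓗) i y → Adj (Cover.H 𝓗) x y
      full {x = x} {y} uv i∈ x∈ y∈ i~x i~y with adj? (Cover.H 𝓗) x y
      ... | yes e = e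
      ... | no ne with f , f-u , f-v , only ← minus-edge-zero G-min uv
        = ⊥-elim (bad (solvable⇒proper {suc κ} fold
            (missing-label (initial {suc κ} fold) stuck (∈-allFin a₀) enough f f-u f-v only i∈ x∈ y∈ i~x i~y ne)))

-- For `κ = 0` the graph has no edges, so `100 * m ^ 3` is zero and every `t` must be covered; hence
-- the condition on `big`. If `t` is zero too, all lists are empty.
bad⇒canonical : ∀ {n} {G : Graph n} κ t (𝓗 : Cover (G ∨ᴳ K t)) → Fin n → MinimallyUncolorable κ G →
  (κ ≢ 0 → bound n κ ≤ t) → IsFold 𝓗 (κ + t) → Bad 𝓗 → Canonical 𝓗 (κ + t)
bad⇒canonical {G = G} zero zero 𝓗 v* G-min big fold bad = FromCover.canonical-empty G 𝓗 fold
bad⇒canonical zero (suc t) 𝓗 v* G-min big fold bad = bad⇒canonical-single v* 𝓗 bad G-min fold zero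
bad⇒canonical (suc κ) zero 𝓗 v* G-min big fold bad with () ← big (λ ())
bad⇒canonical (suc κ) (suc t) 𝓗 v* G-min big fold bad =
  bad⇒canonical-large v* 𝓗 bad κ G-min fold (big λ ()) zero

-- Critical graphs

colorable-mono : ∀ {V : Set} {E : Rel V 0ℓ} {i j} → i ≤ j → Colorable E i → Colorable E j
colorable-mono i≤j (f , proper) = (λ v → inject≤ (f v) i≤j) , λ e p → proper e (FinP.inject≤-injective i≤j i≤j _ _ p)

_─ᵛ_ : ∀ {n} (G : Graph n) → Fin n → Subgraph G
G ─ᵛ v₀ = record
  { verts = ∁ ⁅ v₀ ⁆
  ; SAdj = λ u v → Adj G u v × u ≢ v₀ × v ≢ v₀
  ; sadj? = λ u v → adj? G u v ×-dec (¬? (u Fin.≟ v₀) ×-dec ¬? (v Fin.≟ v₀))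
  ; ssym = λ (e , p , q) → symmetric G e , q , p
  ; ends = λ (e , p , q) → x∉p⇒x∈∁p (x≢y⇒x∉⁅y⁆ p) , x∉p⇒x∈∁p (x≢y⇒x∉⁅y⁆ q)
  ; sadj⊆ = proj₁
  }

SameEdge : ∀ {V : Set} → V → V → V → V → Set
SameEdge u v u′ v′ = (u′ ≡ u × v′ ≡ v) ⊎ (u′ ≡ v × v′ ≡ u)

sameEdge? : ∀ {n} (u v u′ v′ : Fin n) → Dec (SameEdge u v u′ v′)
sameEdge? u v u′ v′ = ((u′ Fin.≟ u) ×-dec (v′ Fin.≟ v)) ⊎-dec ((u′ Fin.≟ v) ×-dec (v′ Fin.≟ u))

sameEdge-sym : ∀ {V : Set} {u v u′ v′ : V} → SameEdge u v u′ v′ → SameEdge u v v′ u′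
sameEdge-sym (inj₁ (p , q)) = inj₂ (q , p)
sameEdge-sym (inj₂ (p , q)) = inj₁ (q , p)

_─ᵉ_ : ∀ {n} (G : Graph n) → Fin n × Fin n → Subgraph G
G ─ᵉ (u , v) = record
  { verts = ⊤
  ; SAdj = λ u′ v′ → Adj G u′ v′ × ¬ SameEdge u v u′ v′
  ; sadj? = λ u′ v′ → adj? G u′ v′ ×-dec ¬? (sameEdge? u v u′ v′)
  ; ssym = λ (e , p) → symmetric G e , p ∘ sameEdge-sym
  ; ends = λ _ → ∈⊤ , ∈⊤
  ; sadj⊆ = proj₁
  }

critical⇒minimal : ∀ {n κ} {G : Graph n} → IsCritical (suc κ) G → MinimallyUncolorable κ G
critical⇒minimal {n} {κ} {G} ((_ , least) , sub) = record
  { uncolorable = λ col → <-irrefl refl (least κ col)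
  ; minus-vertex = λ v₀ →
      let f , proper = reduced (G ─ᵛ v₀) λ (all , _) → x∈∁p⇒x∉p (all v₀) (x∈⁅x⁆ v₀)
      in (λ v v≢ → f (v , x∉p⇒x∈∁p (x≢y⇒x∉⁅y⁆ v≢))) , λ p q e → proper (e , p , q)
  ; minus-edge = λ {u} {v} uv →
      let f , proper = reduced (G ─ᵉ (u , v)) λ (_ , all) → proj₂ (all u v uv) (inj₁ (refl , refl))
      in (λ w → f (w , ∈⊤)) , λ {u′} {v′} e same → only u v u′ v′ λ ne → proper (e , ne) same
  }
  where
  reduced : (G′ : Subgraph G) → Proper G′ → Colorable (VAdj G′) κ
  reduced G′ G′-proper with j , (col , _) , j<k ← sub G′ G′-proper = colorable-mono (s≤s⁻¹ j<k) col
  -- A coloring of `G − uv` excludes only a monochromatic edge known to differ from `uv`;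
  -- decidability removes the double negation.
  only : ∀ u v u′ v′ → ¬ ¬ SameEdge u v u′ v′ → SameEdge u v u′ v′
  only u v u′ v′ ¬¬same with sameEdge? u v u′ v′
  ... | yes e = e
  ... | no ne = ⊥-elim (¬¬same ne)

-- Criticality asks for an exact chromatic number of each proper subgraph; it is found by search
-- below a known bound.
least : ∀ {P : ℕ → Set} → (∀ j → Dec (P j)) → ∀ {N} → P N → ∃ λ j → P j × (∀ i → P i → j ≤ i) × j ≤ N
least P? {N} p with P? 0
... | yes p₀ = 0 , p₀ , (λ _ _ → z≤n) , z≤n
least P? {zero} p | no ¬p₀ = ⊥-elim (¬p₀ p)
least {P} P? {suc N} p | no ¬p₀ with j , pj , minimal , j≤N ← least {P ∘ suc} (P? ∘ suc) p =
  suc j , pj , (λ { zero p₀ → ⊥-elim (¬p₀ p₀) ; (suc i) pi → s≤s (minimal i pi) }) , s≤s j≤N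

any-vec? : ∀ {j} N {P : Vec (Fin j) N → Set} → (∀ xs → Dec (P xs)) → Dec (∃ P)
any-vec? zero P? = map′ ([] ,_) (λ { ([] , p) → p }) (P? [])
any-vec? (suc N) P? = map′ (λ (x , xs , p) → x ∷ xs , p) (λ { (x ∷ xs , p) → x , xs , p })
  (FinP.any? λ x → any-vec? N (P? ∘ (x ∷_)))

-- Colorings are searched for as vectors over all `n` vertices, with zero as default outside the
-- subgraph. Without colors there is no default, so that case is separate.
colorable? : ∀ {n} {G : Graph n} (G′ : Subgraph G) j → Dec (Colorable (VAdj G′) j)
colorable? {n} G′ zero with FinP.any? (_∈? verts G′)
... | yes v = no λ (f , _) → FinP.¬Fin0 (f v)
... | no none = yes ((λ v → ⊥-elim (none v)) , λ {u} _ _ → none u)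
colorable? {n} G′ (suc j) = map′ from to (any-vec? n λ xs → FinP.all? λ u → FinP.all? λ v →
    sadj? G′ u v →-dec ¬? (Vec.lookup xs u Fin.≟ Vec.lookup xs v))
  where
  Good : Vec (Fin (suc j)) n → Set
  Good xs = ∀ u v → SAdj G′ u v → Vec.lookup xs u ≢ Vec.lookup xs v
  from : ∃ Good → Colorable (VAdj G′) (suc j)
  from (xs , proper) = (λ (v , _) → Vec.lookup xs v) , λ {u} {v} → proper (proj₁ u) (proj₁ v)
  to : Colorable (VAdj G′) (suc j) → ∃ Good
  to (f , proper) = Vec.tabulate g , λ u v e p → g-proper u v e
      (trans (sym (Vec.lookup∘tabulate g u)) (trans p (Vec.lookup∘tabulate g v)))
    where
    g : Fin n → Fin (suc j)
    g v with v ∈? verts G′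
    ... | yes v∈ = f (v , v∈)
    ... | no _ = zero
    g-proper : ∀ u v → SAdj G′ u v → g u ≢ g v
    g-proper u v e with u ∈? verts G′ | v ∈? verts G′
    ... | yes _ | yes _ = proper e
    ... | no u∉ | _ = ⊥-elim (u∉ (proj₁ (ends G′ e)))
    ... | yes _ | no v∉ = ⊥-elim (v∉ (proj₂ (ends G′ e)))

missing : ∀ {n} {G : Graph n} (G′ : Subgraph G) → Proper G′ →
  (∃ λ v → v ∉ˢ verts G′) ⊎ (∃ λ u → ∃ λ v → Adj G u v × ¬ SAdj G′ u v)
missing {G = G} G′ G′-proper with FinP.all? (_∈? verts G′)
... | no ¬all = inj₁ (FinP.¬∀⟶∃¬ _ _ (_∈? verts G′) ¬all)
... | yes all with FinP.any? (λ u → FinP.any? (λ v → adj? G u v ×-dec ¬? (sadj? G′ u v)))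
...   | yes (u , v , e , ¬e) = inj₂ (u , v , e , ¬e)
...   | no none = ⊥-elim (G′-proper (all , λ u v e → present u v e))
  where
  present : ∀ u v → Adj G u v → SAdj G′ u v
  present u v e with sadj? G′ u v
  ... | yes s = s
  ... | no ¬s = ⊥-elim (none (u , v , e , ¬s))

minimal⇒lower : ∀ {n κ} {G : Graph n} → MinimallyUncolorable κ G → ∀ j → Colorable (Adj G) j → suc κ ≤ j
minimal⇒lower {κ = κ} G-min j col with suc κ ≤? j
... | yes ≤j = ≤j
... | no ≰j = ⊥-elim (uncolorable G-min (colorable-mono (s≤s⁻¹ (≰⇒> ≰j)) col))

coloring-isolating : ∀ {n κ} {G : Graph n} → MinimallyUncolorable κ G → ∀ v₀ →
  ∃ λ (h : Fin n → Fin (suc κ)) → (∀ {u v} → Adj G u v → h u ≢ h v) × (∀ v → h v ≡ zero → v ≡ v₀)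
coloring-isolating {n} {κ} {G} G-min v₀ with f , proper ← minus-vertex G-min v₀ = h , h-proper , only
  where
  h : Fin n → Fin (suc κ)
  h v with v Fin.≟ v₀
  ... | yes _ = zero
  ... | no v≢ = suc (f v v≢)
  h-proper : ∀ {u v} → Adj G u v → h u ≢ h v
  h-proper {u} {v} uv p with u Fin.≟ v₀ | v Fin.≟ v₀
  ... | yes refl | yes refl = loopless G refl uv
  ... | no u≢ | no v≢ = proper u≢ v≢ uv (FinP.suc-injective p)
  only : ∀ v → h v ≡ zero → v ≡ v₀
  only v e with v Fin.≟ v₀
  ... | yes v≡ = v≡

minimal⇒critical : ∀ {n κ} {G : Graph n} → Fin n → MinimallyUncolorable κ G → IsCritical (suc κ) G
minimal⇒critical {n} {κ} {G} v* G-min =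
  (let h , proper , _ = coloring-isolating G-min v* in (h , proper) , minimal⇒lower G-min) , reduce
  where
  reduced : (G′ : Subgraph G) → Proper G′ → Colorable (VAdj G′) κ
  reduced G′ G′-proper with missing G′ G′-proper
  ... | inj₁ (v₀ , v₀∉) with f , proper ← minus-vertex G-min v₀ =
    (λ (v , v∈) → f v λ { refl → v₀∉ v∈ }) , λ e → proper _ _ (sadj⊆ G′ e)
  ... | inj₂ (u , v , uv , ¬uv) with f , only ← minus-edge G-min uv = f ∘ proj₁ , λ {x} {y} e p → clash e (only (sadj⊆ G′ e) p)
    where
    clash : ∀ {x y} → SAdj G′ x y → ¬ SameEdge u v x y
    clash e (inj₁ (refl , refl)) = ¬uv e
    clash e (inj₂ (refl , refl)) = ¬uv (ssym G′ e)
  reduce : (G′ : Subgraph G) → Proper G′ → ∃ λ j → (χ VAdj G′ ≐ j) × j < suc κ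
  reduce G′ G′-proper with j , col , minimal , j≤κ ← least (colorable? G′) (reduced G′ G′-proper) =
    j , (col , minimal) , s≤s j≤κ

-- Criticality of the join

↑ˡ≢↑ʳ : ∀ {m n} (i : Fin m) (j : Fin n) → i ↑ˡ n ≢ m ↑ʳ j
↑ˡ≢↑ʳ {m} {n} i j e with () ← trans (sym (FinP.splitAt-↑ˡ m i n)) (trans (cong (splitAt m) e) (FinP.splitAt-↑ʳ m n j))

splitAt-injective : ∀ m {n} {i j : Fin (m + n)} → splitAt m i ≡ splitAt m j → i ≡ j
splitAt-injective m {n} {i} {j} e =
  trans (sym (FinP.join-splitAt m n i)) (trans (cong (join m n) e) (FinP.join-splitAt m n j))

-- By induction on `t`: the color of the first vertex of `K t` occurs nowhere else and can be
-- punched out.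
colors-join-K : ∀ {n κ} {G : Graph n} → MinimallyUncolorable κ G → ∀ t {j} (f : Fin n → Fin j) (g : Fin t → Fin j) →
  (∀ {u v} → Adj G u v → f u ≢ f v) → (∀ {a b} → a ≢ b → g a ≢ g b) → (∀ v a → g a ≢ f v) → suc κ + t ≤ j
colors-join-K {κ = κ} G-min zero f g f-proper _ _ =
  ≤-trans (≤-reflexive (+-identityʳ (suc κ))) (minimal⇒lower G-min _ (f , f-proper))
colors-join-K G-min (suc t) {zero} f g _ _ _ with () ← g zero
colors-join-K {κ = κ} G-min (suc t) {suc j} f g f-proper g-proper apart =
  ≤-trans (≤-reflexive (+-suc (suc κ) t)) (s≤s (colors-join-K G-min t
    (λ v → punchOut (apart v zero)) (λ a → punchOut (g-proper {zero} {suc a} λ ()))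
    (λ {u} {v} e p → f-proper e (FinP.punchOut-injective (apart u zero) (apart v zero) p))
    (λ a≢b p → g-proper (a≢b ∘ FinP.suc-injective) (FinP.punchOut-injective (g-proper λ ()) (g-proper λ ()) p))
    (λ v a p → apart v (suc a) (FinP.punchOut-injective (g-proper λ ()) (apart v zero) p))))

module JoinMinimal {n κ : ℕ} {G : Graph n} (G-min : MinimallyUncolorable κ G) (v* : Fin n) (t : ℕ) where

  W : Set
  W = Fin n ⊎ Fin t

  J : W → W → Set
  J = JoinAdj G (K t)

  -- The color zero of G is identified with the color of the vertex a of K t.
  paint : Fin t → Fin (suc κ) → Fin (κ + t)
  paint a zero = κ ↑ʳ a
  paint a (suc i) = i ↑ˡ t

  paint-injective : ∀ a {i j} → paint a i ≡ paint a j → i ≡ j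
  paint-injective a {zero} {zero} _ = refl
  paint-injective a {zero} {suc j} e = ⊥-elim (↑ˡ≢↑ʳ j a (sym e))
  paint-injective a {suc i} {zero} e = ⊥-elim (↑ˡ≢↑ʳ i a e)
  paint-injective a {suc i} {suc j} e = cong suc (FinP.↑ˡ-injective t i j e)

  paint-≡-↑ʳ : ∀ a b {i} → paint a i ≡ κ ↑ʳ b → i ≡ zero × a ≡ b
  paint-≡-↑ʳ a b {zero} e = refl , FinP.↑ʳ-injective κ a b e
  paint-≡-↑ʳ a b {suc i} e = ⊥-elim (↑ˡ≢↑ʳ i b e)

  spread : (Fin n → Fin (suc κ)) → Fin t → W → Fin (κ + t)
  spread h a (inj₁ v) = paint a (h v)
  spread h a (inj₂ b) = κ ↑ʳ b

  -- Only the color of `a` is used both on `K t` and on `G`, and on `G` only where `h` is zero.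
  spread-clash : ∀ {h} → (∀ {u v} → Adj G u v → h u ≢ h v) → ∀ a {x y} → J x y → spread h a x ≡ spread h a y →
    ∃ λ v → h v ≡ zero × SameEdge (inj₁ v) (inj₂ a) x y
  spread-clash proper a {inj₁ u} {inj₁ v} uv e = ⊥-elim (proper uv (paint-injective a e))
  spread-clash proper a {inj₁ u} {inj₂ b} _ e with z , refl ← paint-≡-↑ʳ a b e = u , z , inj₁ (refl , refl)
  spread-clash proper a {inj₂ b} {inj₁ v} _ e with z , refl ← paint-≡-↑ʳ a b (sym e) = v , z , inj₂ (refl , refl)
  spread-clash proper a {inj₂ b} {inj₂ c} b≢c e = ⊥-elim (b≢c (FinP.↑ʳ-injective κ b c e))

  -- The vertex `a` borrows the color of `b`, which frees its own color for the color zero of `G`.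
  merge : Fin t → Fin t → Fin t → Fin t
  merge a b c with c Fin.≟ a
  ... | yes _ = b
  ... | no _ = c

  merge-≢ : ∀ {a b} → a ≢ b → ∀ c → merge a b c ≢ a
  merge-≢ {a} {b} a≢b c e with c Fin.≟ a
  ... | yes _ = a≢b (sym e)
  ... | no ne = ne e

  merge-clash : ∀ a b {c d} → c ≢ d → merge a b c ≡ merge a b d → SameEdge a b c d
  merge-clash a b {c} {d} c≢d e with c Fin.≟ a | d Fin.≟ a
  ... | yes c≡ | yes d≡ = ⊥-elim (c≢d (trans c≡ (sym d≡)))
  ... | yes c≡ | no _ = inj₁ (c≡ , sym e)
  ... | no _ | yes d≡ = inj₂ (e , d≡)
  ... | no _ | no _ = ⊥-elim (c≢d e)

  -- Without `v₀` the rest of `G` needs `κ` colors and `K t` its own `t`. Without `a` the color of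
  -- `a` serves as the additional color of `G`.
  join-minus-vertex : ∀ w₀ → ∃ λ (f : ∀ w → w ≢ w₀ → Fin (κ + t)) → ∀ {x y} p q → J x y → f x p ≢ f y q
  join-minus-vertex (inj₁ v₀) with f , proper ← minus-vertex G-min v₀ = g , g-proper
    where
    g : ∀ w → w ≢ inj₁ v₀ → Fin (κ + t)
    g (inj₁ v) v≢ = f v (v≢ ∘ cong inj₁) ↑ˡ t
    g (inj₂ a) _ = κ ↑ʳ a
    g-proper : ∀ {x y} p q → J x y → g x p ≢ g y q
    g-proper {inj₁ u} {inj₁ v} p q uv e = proper _ _ uv (FinP.↑ˡ-injective t _ _ e)
    g-proper {inj₁ u} {inj₂ b} p q _ e = ↑ˡ≢↑ʳ _ b e
    g-proper {inj₂ a} {inj₁ v} p q _ e = ↑ˡ≢↑ʳ _ a (sym e)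
    g-proper {inj₂ a} {inj₂ b} p q a≢b e = a≢b (FinP.↑ʳ-injective κ a b e)
  join-minus-vertex (inj₂ a) with h , proper , _ ← coloring-isolating G-min v* =
    (λ w _ → spread h a w) , λ p q e same → excluded p q (proj₂ (proj₂ (spread-clash proper a e same)))
    where
    excluded : ∀ {v : Fin n} {x y : W} → x ≢ inj₂ a → y ≢ inj₂ a → ¬ SameEdge (inj₁ v) (inj₂ a) x y
    excluded p q (inj₁ (_ , y≡)) = q y≡
    excluded p q (inj₂ (x≡ , _)) = p x≡

  -- As `h` is zero only at `u`, the edge from `u` to `a` is the only one that can clash.
  join-minus-mixed : ∀ u a → ∃ λ (f : W → Fin (κ + t)) → ∀ {x y} → J x y → f x ≡ f y → SameEdge (inj₁ u) (inj₂ a) x y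
  join-minus-mixed u a with h , proper , only ← coloring-isolating G-min u = spread h a , clash
    where
    clash : ∀ {x y} → J x y → spread h a x ≡ spread h a y → SameEdge (inj₁ u) (inj₂ a) x y
    clash e same with v , z , s ← spread-clash proper a e same with refl ← only v z = s

  join-minus-edge : ∀ {w w′} → J w w′ → ∃ λ (f : W → Fin (κ + t)) → ∀ {x y} → J x y → f x ≡ f y → SameEdge w w′ x y
  join-minus-edge {inj₁ u} {inj₁ v} uv with f , only ← minus-edge G-min uv = g , clash
    where
    g : W → Fin (κ + t)
    g (inj₁ v) = f v ↑ˡ t
    g (inj₂ a) = κ ↑ʳ a
    clash : ∀ {x y} → J x y → g x ≡ g y → SameEdge (inj₁ u) (inj₁ v) x y
    clash {inj₁ _} {inj₁ _} e p = Sum.map both both (only e (FinP.↑ˡ-injective t _ _ p))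
      where
      both : ∀ {a b c d : Fin n} → a ≡ b × c ≡ d → inj₁ a ≡ inj₁ b × inj₁ c ≡ inj₁ d
      both (p , q) = cong inj₁ p , cong inj₁ q
    clash {inj₁ _} {inj₂ b} _ p = ⊥-elim (↑ˡ≢↑ʳ _ b p)
    clash {inj₂ a} {inj₁ _} _ p = ⊥-elim (↑ˡ≢↑ʳ _ a (sym p))
    clash {inj₂ a} {inj₂ b} a≢b p = ⊥-elim (a≢b (FinP.↑ʳ-injective κ a b p))
  join-minus-edge {inj₁ u} {inj₂ a} _ = join-minus-mixed u a
  join-minus-edge {inj₂ a} {inj₁ u} _ with f , clash ← join-minus-mixed u a = f , λ e p → Sum.swap (clash e p)
  join-minus-edge {inj₂ a} {inj₂ b} a≢b with h , proper , _ ← coloring-isolating G-min v* = g , clash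
    where
    g : W → Fin (κ + t)
    g (inj₁ v) = paint a (h v)
    g (inj₂ c) = κ ↑ʳ merge a b c
    clash : ∀ {x y} → J x y → g x ≡ g y → SameEdge (inj₂ a) (inj₂ b) x y
    clash {inj₁ _} {inj₁ _} e p = ⊥-elim (proper e (paint-injective a p))
    clash {inj₁ u} {inj₂ c} _ p = ⊥-elim (merge-≢ a≢b c (sym (proj₂ (paint-≡-↑ʳ a _ {h u} p))))
    clash {inj₂ c} {inj₁ v} _ p = ⊥-elim (merge-≢ a≢b c (sym (proj₂ (paint-≡-↑ʳ a _ {h v} (sym p)))))
    clash {inj₂ c} {inj₂ d} c≢d p = Sum.map both both (merge-clash a b c≢d (FinP.↑ʳ-injective κ _ _ p))
      where
      both : ∀ {a b c d : Fin t} → a ≡ b × c ≡ d → inj₂ a ≡ inj₂ b × inj₂ c ≡ inj₂ d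
      both (p , q) = cong inj₂ p , cong inj₂ q

  join-uncolorable : ¬ Colorable (Adj (G ∨ᴳ K t)) (κ + t)
  join-uncolorable (c , proper) = <-irrefl refl (colors-join-K G-min t (c ∘ (_↑ˡ t)) (c ∘ (n ↑ʳ_))
    (λ {u} {v} e → proper {u ↑ˡ t} {v ↑ˡ t} (subst₂ J (sym (FinP.splitAt-↑ˡ n u t)) (sym (FinP.splitAt-↑ˡ n v t)) e))
    (λ {a} {b} e → proper {n ↑ʳ a} {n ↑ʳ b} (subst₂ J (sym (FinP.splitAt-↑ʳ n t a)) (sym (FinP.splitAt-↑ʳ n t b)) e))
    (λ v a → proper {n ↑ʳ a} {v ↑ˡ t} (subst₂ J (sym (FinP.splitAt-↑ʳ n t a)) (sym (FinP.splitAt-↑ˡ n v t)) tt)))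

  join-minimal : MinimallyUncolorable (κ + t) (G ∨ᴳ K t)
  join-minimal = record
    { uncolorable = join-uncolorable
    ; minus-vertex = λ w → let f , proper = join-minus-vertex (splitAt n w) in
        (λ v v≢ → f (splitAt n v) (v≢ ∘ splitAt-injective n)) , λ p q → proper _ _
    ; minus-edge = λ {u} {v} uv → let f , only = join-minus-edge {splitAt n u} {splitAt n v} uv in
        f ∘ splitAt n , λ {x} {y} e p → Sum.map both both (only {splitAt n x} {splitAt n y} e p)
    }
    where
    both : ∀ {x u y v : Fin (n + t)} → splitAt n x ≡ splitAt n u × splitAt n y ≡ splitAt n v → x ≡ u × y ≡ v
    both (p , q) = splitAt-injective n p , splitAt-injective n q

-- Bounds in terms of the number of edges

covering-length : ∀ {n} (xs : List (Fin n)) → (∀ v → v ∈ xs) → n ≤ length xs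
covering-length {n} xs cover
  -- Each entry of `xs` removes at most one vertex from `allFin n`, and none may remain.
  with thin {Q = λ x v → x ≡ v} (λ x v → x Fin.≟ v) xs (allFin⁺ n) (λ _ _ _ p q → trans (sym p) q)
... | [] , _ , _ , len = subst₂ _≤_ (length-allFin n) (+-identityʳ _) len
... | v ∷ _ , _ , sub , _ = ⊥-elim (proj₂ (sub (here refl)) (cover v) refl)

module _ {n κ : ℕ} {G : Graph n} (G-min : MinimallyUncolorable κ G) where

  -- A coloring of `G − v` with at least one color extends to an isolated `v` by any color.
  has-neighbor : κ ≢ 0 → ∀ v → ∃ (Adj G v)
  has-neighbor κ≢0 v with FinP.any? (adj? G v)
  ... | yes p = p
  has-neighbor κ≢0 v | no isolated = ⊥-elim (impossible κ κ≢0 G-min)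
    where
    impossible : ∀ κ → κ ≢ 0 → ¬ MinimallyUncolorable κ G
    impossible zero κ≢0 _ = κ≢0 refl
    impossible (suc κ) _ G-min with f , proper ← minus-vertex-total G-min v =
      uncolorable G-min (f , λ {x} {y} e → proper (λ { refl → isolated (y , e) }) (λ { refl → isolated (x , symmetric G e) }) e)

  -- Every vertex is an end of some edge, so the ends of all edges cover the vertices.
  order≤2size : κ ≢ 0 → n ≤ edgeCount G * 2
  order≤2size κ≢0 = subst (n ≤_) (length-ends edges) (covering-length (concatMap endpoints edges) cover)
    where
    edge? : ∀ (e : Fin n × Fin n) → Dec (proj₁ e Fin.< proj₂ e × Adj G (proj₁ e) (proj₂ e))
    edge? e = (proj₁ e FinP.<? proj₂ e) ×-dec adj? G (proj₁ e) (proj₂ e)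
    edges : List (Fin n × Fin n)
    edges = filter edge? (cartesianProduct (allFin n) (allFin n))
    endpoints : Fin n × Fin n → List (Fin n)
    endpoints (u , v) = u ∷ v ∷ []
    length-ends : ∀ es → length (concatMap endpoints es) ≡ length es * 2
    length-ends [] = refl
    length-ends (e ∷ es) = cong (2 +_) (length-ends es)
    edge∈ : ∀ {u v} → u Fin.< v → Adj G u v → (u , v) ∈ edges
    edge∈ {u} {v} u<v uv = ∈-filter⁺ edge? (∈-cartesianProduct⁺ (∈-allFin u) (∈-allFin v)) (u<v , uv)
    cover : ∀ v → v ∈ concatMap endpoints edges
    cover v with u , vu ← has-neighbor κ≢0 v with FinP.<-cmp v u
    ... | tri< v<u _ _ = ∈-concatMap⁺ endpoints (lose (edge∈ v<u vu) (here refl))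
    ... | tri≈ _ refl _ = ⊥-elim (loopless G refl vu)
    ... | tri> _ _ u<v = ∈-concatMap⁺ endpoints (lose (edge∈ u<v (symmetric G vu)) (there (here refl)))

  -- Coloring every vertex by itself is proper.
  κ≤order : κ ≤ n
  κ≤order with κ ≤? n
  ... | yes p = p
  ... | no p = ⊥-elim (uncolorable G-min (colorable-mono (<⇒≤ (≰⇒> p)) (id , λ { e refl → loopless G refl e })))

bound-mono : ∀ {n n′ κ κ′} → n ≤ n′ → κ ≤ κ′ → bound n κ ≤ bound n′ κ′
bound-mono p q = +-monoʳ-≤ 2 (+-mono-≤ (*-monoʳ-≤ 2 (*-mono-≤ p (s≤s p))) (+-mono-≤ p (*-mono-≤ q (s≤s (*-mono-≤ p p)))))

bound-cubic : ∀ m → 1 ≤ m → bound (m * 2) (m * 2) ≤ 100 * m ^ 3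
bound-cubic (suc p) _ = subst (bound (suc p * 2) (suc p * 2) ≤_) (sym (difference p)) (m≤m+n _ _)
  where
  open +-*-Solver
  difference : ∀ p → 100 * suc p ^ 3 ≡
    -- With `m = suc p` the bound is `8m³ + 8m² + 8m + 2`; the remainder `92m³ − 8m² − 8m − 2` has
    -- nonnegative coefficients when expanded in `p`.
    bound (suc p * 2) (suc p * 2) + (74 + 252 * p + 268 * (p * p) + 92 * (p * (p * p)))
  difference = solve 1 (λ p →
    let m = con 1 :+ p ; n = m :* con 2 in
    con 100 :* (m :* (m :* (m :* con 1))) :=
    con 2 :+ (con 2 :* (n :* (con 1 :+ n)) :+ (n :+ n :* (con 1 :+ n :* n))) :+
    (con 74 :+ con 252 :* p :+ con 268 :* (p :* p) :+ con 92 :* (p :* (p :* p)))) refl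

theorem1p10 : ∀ {n} (G : Graph n) (m : ℕ) → Critical G → edgeCount G ≡ m →
    ∀ (t : ℕ) → 100 * m ^ 3 ≤ t → RobustlyCritical (G ∨ᴳ K t)
theorem1p10 {zero} G m (k , 1≤k , (_ , lower) , _) _ t _ =
  -- The empty graph is colorable with no colors, so its chromatic number is not positive.
  ⊥-elim (<⇒≱ 1≤k (lower 0 ((λ ()) , λ { {()} })))
theorem1p10 {suc n} G m (suc κ , _ , critical) refl t large =
  suc (κ + t) , s≤s z≤n , minimal⇒critical zero (JoinMinimal.join-minimal G-min zero t) ,
  λ 𝓗 → bad⇒canonical κ t 𝓗 zero G-min enough
  where
  G-min : MinimallyUncolorable κ G
  G-min = critical⇒minimal critical
  enough : κ ≢ 0 → bound (suc n) κ ≤ t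
  enough κ≢0 = ≤-trans (bound-mono n≤2m (≤-trans (κ≤order G-min) n≤2m)) (≤-trans (bound-cubic m 1≤m) large)
    where
    n≤2m : suc n ≤ m * 2
    n≤2m = order≤2size G-min κ≢0
    1≤m : 1 ≤ m
    1≤m with m | n≤2m
    ... | suc _ | _ = s≤s z≤n
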